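{- Let $D=(V_1\cup V_2,E)$ be a bipartite digraph with all edges oriented from $V_1$ to $V_2$, with maximum in-degree $\Delta^-\ge 1$ and maximum out-degree $\Delta^+$. Let $a,b,c\in\mathbb{N}$ be integers and $\delta>0$ be a real parameter such that $a\ge b\ge 32|V_1|$ and $$\delta\le \frac{\left(2^{ -1/2}\,\frac{b}{a}\right)^{\Delta^- }}{4\Delta^+\Delta^- }.$$ Let $T$ be a tournament and let $A,B\subseteq V(T)$ be subsets of its vertices such that $|A|=a$ and for all but at most a $\delta$-fraction of the subsets $S\subseteq A$ of size $\Delta^-$ we have $|N_T^+(S)\cap B|\ge c$. Let $f:V_1\to 2^A$ be a function such that $|f(v)|\ge b$ for each $v\in V_1$. Then there exists an injective function $\phi:V_1\to A$ such that for each $v\in V_1$ we have $\phi(v)\in f(v)$, and for each $u\in V_2$ we have $|N_T^+(\phi(N_D^-(u)))\cap B|\ge c$.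
   Context: A tournament is an orientation of the edges of a finite complete graph. $2^A$ denotes the set of all subsets of $A$. For a vertex $u$ of a digraph $D$, $N_D^-(u)$ is its in-neighborhood. For a set $S$ of vertices of $T$, $N_T^+(S)$ denotes the common out-neighborhood of $S$, i.e. the set of vertices of $T$ that are out-neighbors of every vertex of $S$ (so $N_T^+(\varnothing)=V(T)$). -}

module Defs where

open import Data.Bool using (Bool)
open import Data.Fin using (Fin)
import Data.Fin as Fin
open import Data.Fin.Properties using (any?; all?)
open import Data.Fin.Subset using (Subset; inside; outside; _∈_; ∣_∣; _∩_)
open import Data.Fin.Subset.Properties using (_∈?_; _⊆?_)
open import Data.Integer as ℤ using (+_; +0; +[1+_]; -[1+_])
import Data.Integer.Properties as ℤ
open import Data.List using (List; []; _∷_; _++_; map; filter; length; allFin)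
open import Data.List.Extrema.Nat using (max)
open import Data.Nat using (ℕ; zero; suc)
import Data.Nat as ℕ
import Data.Nat.Properties as ℕ
import Data.Nat.Solver as ℕ
open import Data.Product using (Σ; ∃; ∃-syntax; _×_; _,_; proj₁; proj₂)
open import Data.Rational as ℚ using (ℚ; mkℚ; 0ℚ; 1ℚ; ½)
import Data.Rational.Properties as ℚ
import Data.Rational.Solver as ℚ
import Data.Rational.Unnormalised as ℚᵘ
import Data.Rational.Unnormalised.Properties as ℚᵘ
open import Data.Sum using (inj₁; inj₂)
open import Data.Vec using (tabulate)
import Data.Vec as Vec
open import Function using (_∘_)
open import Level using (0ℓ)
open import Relation.Binary using (Rel; REL; Decidable; Trichotomous)
open import Relation.Binary.Consequences using (tri⇒dec<)
open import Relation.Binary.PropositionalEquality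
open import Relation.Nullary using (does; yes; no; ¬_)
open import Relation.Nullary.Decidable using (_×-dec_; _→-dec_; ¬?)
import Relation.Unary as U

-- Real numbers are Cauchy sequences of rationals, compared up to _≃ℝ_.
record ℝ : Set where
  constructor mkℝ
  field
    seq    : ℕ → ℚ
    cauchy : ∀ ε → 0ℚ ℚ.< ε →
             ∃[ N ] (∀ i j → N ℕ.≤ i → N ℕ.≤ j → ℚ.∣ seq i ℚ.- seq j ∣ ℚ.≤ ε)

open ℝ public

infix 4 _≤ℝ_ _<ℝ_ _≃ℝ_

_≤ℝ_ : ℝ → ℝ → Set
x ≤ℝ y = ∀ ε → 0ℚ ℚ.< ε → ∃[ N ] (∀ i → N ℕ.≤ i → seq x i ℚ.≤ seq y i ℚ.+ ε)

_<ℝ_ : ℝ → ℝ → Set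
x <ℝ y = ∃[ ε ] 0ℚ ℚ.< ε × ∃[ N ] (∀ i → N ℕ.≤ i → seq x i ℚ.+ ε ℚ.≤ seq y i)

_≃ℝ_ : ℝ → ℝ → Set
x ≃ℝ y = x ≤ℝ y × y ≤ℝ x

fromℚ : ℚ → ℝ
fromℚ q = mkℝ (λ _ → q) λ ε 0<ε → 0 , λ _ _ _ _ →
  subst (ℚ._≤ ε) (sym (cong ℚ.∣_∣ (ℚ.+-inverseʳ q))) (ℚ.<⇒≤ 0<ε)

fromℕ : ℕ → ℝ
fromℕ n = fromℚ (+ n ℚ./ 1)

0ℝ 1ℝ : ℝ
0ℝ = fromℕ 0
1ℝ = fromℕ 1

private
  bounded : (x : ℝ) → ∃[ b ] 0ℚ ℚ.< b × ∃[ N ] (∀ i → N ℕ.≤ i → ℚ.∣ seq x i ∣ ℚ.≤ b)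
  bounded x with cauchy x 1ℚ (ℚ.positive⁻¹ 1ℚ)
  ... | N , close = 1ℚ ℚ.+ ℚ.∣ q ∣ , 0<b , N , bound
    where
    q = seq x N
    0<b : 0ℚ ℚ.< 1ℚ ℚ.+ ℚ.∣ q ∣
    0<b = ℚ.+-mono-<-≤ (ℚ.positive⁻¹ 1ℚ) (ℚ.0≤∣p∣ q)
    open ℚ.≤-Reasoning
    open ℚ.+-*-Solver
    bound : ∀ i → N ℕ.≤ i → ℚ.∣ seq x i ∣ ℚ.≤ 1ℚ ℚ.+ ℚ.∣ q ∣
    bound i N≤i = begin
      ℚ.∣ p ∣                    ≡⟨ cong ℚ.∣_∣ (solve 2 (λ p q → p := (p :- q) :+ q) refl p q) ⟩
      ℚ.∣ (p ℚ.- q) ℚ.+ q ∣      ≤⟨ ℚ.∣p+q∣≤∣p∣+∣q∣ (p ℚ.- q) q ⟩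
      ℚ.∣ p ℚ.- q ∣ ℚ.+ ℚ.∣ q ∣  ≤⟨ ℚ.+-monoˡ-≤ ℚ.∣ q ∣ (close i N N≤i ℕ.≤-refl) ⟩
      1ℚ ℚ.+ ℚ.∣ q ∣             ∎
      where p = seq x i

  *-mono-≤ : ∀ {p q r s} → 0ℚ ℚ.≤ p → 0ℚ ℚ.≤ s → p ℚ.≤ q → r ℚ.≤ s → p ℚ.* r ℚ.≤ q ℚ.* s
  *-mono-≤ {p} {q} {r} {s} 0≤p 0≤s p≤q r≤s = ℚ.≤-trans
    (ℚ.*-monoˡ-≤-nonNeg p {{ℚ.nonNegative 0≤p}} r≤s)
    (ℚ.*-monoʳ-≤-nonNeg s {{ℚ.nonNegative 0≤s}} p≤q)

infixl 7 _*ℝ_ _÷ℝ_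
infixr 8 _^ℝ_

_*ℝ_ : ℝ → ℝ → ℝ
x *ℝ y = mkℝ (λ i → seq x i ℚ.* seq y i) λ ε 0<ε →
  let
    (b , 0<b , Nb , ∣x∣≤b) = bounded x
    (c , 0<c , Nc , ∣y∣≤c) = bounded y
    d    = b ℚ.+ c
    0<d  = ℚ.+-mono-< 0<b 0<c
    instance
      d⁺ = ℚ.positive 0<d
      d≢0 = ℚ.pos⇒nonZero d
      r⁺ = ℚ.1/pos⇒pos d
      ε⁺ = ℚ.positive 0<ε
    η    = ε ℚ.* ℚ.1/ d
    0<η  = ℚ.positive⁻¹ η {{ℚ.pos*pos⇒pos ε (ℚ.1/ d)}}
    (Nx , x-close) = cauchy x η 0<η
    (Ny , y-close) = cauchy y η 0<η
    N = (Nb ℕ.⊔ Nc) ℕ.⊔ (Nx ℕ.⊔ Ny)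
    Nb≤ = ℕ.≤-trans (ℕ.m≤m⊔n Nb Nc) (ℕ.m≤m⊔n (Nb ℕ.⊔ Nc) (Nx ℕ.⊔ Ny))
    Nc≤ = ℕ.≤-trans (ℕ.m≤n⊔m Nb Nc) (ℕ.m≤m⊔n (Nb ℕ.⊔ Nc) (Nx ℕ.⊔ Ny))
    Nx≤ = ℕ.≤-trans (ℕ.m≤m⊔n Nx Ny) (ℕ.m≤n⊔m (Nb ℕ.⊔ Nc) (Nx ℕ.⊔ Ny))
    Ny≤ = ℕ.≤-trans (ℕ.m≤n⊔m Nx Ny) (ℕ.m≤n⊔m (Nb ℕ.⊔ Nc) (Nx ℕ.⊔ Ny))
    open ℚ.≤-Reasoning
    open ℚ.+-*-Solver
  in N , λ i j N≤i N≤j →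
  let
    p  = seq x i ; p′ = seq x j
    q  = seq y i ; q′ = seq y j
  in begin
    ℚ.∣ p ℚ.* q ℚ.- p′ ℚ.* q′ ∣
      ≡⟨ cong ℚ.∣_∣ (solve 4 (λ p q p′ q′ →
           p :* q :- p′ :* q′ := p :* (q :- q′) :+ (p :- p′) :* q′) refl p q p′ q′) ⟩
    ℚ.∣ p ℚ.* (q ℚ.- q′) ℚ.+ (p ℚ.- p′) ℚ.* q′ ∣
      ≤⟨ ℚ.∣p+q∣≤∣p∣+∣q∣ (p ℚ.* (q ℚ.- q′)) ((p ℚ.- p′) ℚ.* q′) ⟩
    ℚ.∣ p ℚ.* (q ℚ.- q′) ∣ ℚ.+ ℚ.∣ (p ℚ.- p′) ℚ.* q′ ∣
      ≡⟨ cong₂ ℚ._+_ (ℚ.∣p*q∣≡∣p∣*∣q∣ p (q ℚ.- q′)) (ℚ.∣p*q∣≡∣p∣*∣q∣ (p ℚ.- p′) q′) ⟩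
    ℚ.∣ p ∣ ℚ.* ℚ.∣ q ℚ.- q′ ∣ ℚ.+ ℚ.∣ p ℚ.- p′ ∣ ℚ.* ℚ.∣ q′ ∣
      ≤⟨ ℚ.+-mono-≤
           (*-mono-≤ (ℚ.0≤∣p∣ p) (ℚ.<⇒≤ 0<η)
             (∣x∣≤b i (ℕ.≤-trans Nb≤ N≤i))
             (y-close i j (ℕ.≤-trans Ny≤ N≤i) (ℕ.≤-trans Ny≤ N≤j)))
           (*-mono-≤ (ℚ.0≤∣p∣ (p ℚ.- p′)) (ℚ.<⇒≤ 0<c)
             (x-close i j (ℕ.≤-trans Nx≤ N≤i) (ℕ.≤-trans Nx≤ N≤j))
             (∣y∣≤c j (ℕ.≤-trans Nc≤ N≤j))) ⟩
    b ℚ.* η ℚ.+ η ℚ.* c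
      ≡⟨ solve 4 (λ b c ε r → b :* (ε :* r) :+ (ε :* r) :* c := ε :* ((b :+ c) :* r))
           refl b c ε (ℚ.1/ d) ⟩
    ε ℚ.* (d ℚ.* ℚ.1/ d)
      ≡⟨ cong (ε ℚ.*_) (ℚ.*-inverseʳ d) ⟩
    ε ℚ.* 1ℚ
      ≡⟨ ℚ.*-identityʳ ε ⟩
    ε ∎

_^ℝ_ : ℝ → ℕ → ℝ
x ^ℝ zero  = 1ℝ
x ^ℝ suc n = x *ℝ x ^ℝ n

-- Division by a natural number, with the junk value x ÷ℝ 0 = 0.
_÷ℝ_ : ℝ → ℕ → ℝ
x ÷ℝ zero  = 0ℝ
x ÷ℝ suc n = x *ℝ fromℚ (+ 1 ℚ./ suc n)

-- Opaque only to keep type checking fast.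
opaque
  -- ⌊√n⌋
  isqrt : ℕ → ℕ
  isqrt zero    = 0
  isqrt (suc n) with suc (isqrt n) ℕ.* suc (isqrt n) ℕ.≤? suc n
  ... | yes _ = suc (isqrt n)
  ... | no  _ = isqrt n

  isqrt-lower : ∀ n → isqrt n ℕ.* isqrt n ℕ.≤ n
  isqrt-lower zero = ℕ.z≤n
  isqrt-lower (suc n) with suc (isqrt n) ℕ.* suc (isqrt n) ℕ.≤? suc n
  ... | yes p = p
  ... | no  _ = ℕ.m≤n⇒m≤1+n (isqrt-lower n)

  isqrt-upper : ∀ n → n ℕ.< suc (isqrt n) ℕ.* suc (isqrt n)
  isqrt-upper zero = ℕ.s≤s ℕ.z≤n
  isqrt-upper (suc n) with suc (isqrt n) ℕ.* suc (isqrt n) ℕ.≤? suc n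
  ... | yes _ = ℕ.≤-<-trans (isqrt-upper n)
                  (ℕ.*-mono-< (ℕ.n<1+n (suc (isqrt n))) (ℕ.n<1+n (suc (isqrt n))))
  ... | no ¬p = ℕ.≰⇒> ¬p

private
  module _ {m n d e : ℕ} .{{_ : ℕ.NonZero d}} .{{_ : ℕ.NonZero e}} where

    frac-≤ : m ℕ.* e ℕ.≤ n ℕ.* d → + m ℚ./ d ℚ.≤ + n ℚ./ e
    frac-≤ = go d e
      where
      go : ∀ d e .{{_ : ℕ.NonZero d}} .{{_ : ℕ.NonZero e}} →
           m ℕ.* e ℕ.≤ n ℕ.* d → + m ℚ./ d ℚ.≤ + n ℚ./ e
      go (suc d) (suc e) le = ℚ.toℚᵘ-cancel-≤
        (ℚᵘ.≤-respˡ-≃ (ℚᵘ.≃-sym (ℚ.toℚᵘ-fromℚᵘ (ℚᵘ.mkℚᵘ (+ m) d)))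
        (ℚᵘ.≤-respʳ-≃ (ℚᵘ.≃-sym (ℚ.toℚᵘ-fromℚᵘ (ℚᵘ.mkℚᵘ (+ n) e)))
        (ℚᵘ.*≤* (subst₂ ℤ._≤_ (ℤ.pos-* m (suc e)) (ℤ.pos-* n (suc d)) (ℤ.+≤+ le)))))

  fromℚᵘ-+ : ∀ p q → ℚ.fromℚᵘ (p ℚᵘ.+ q) ≡ ℚ.fromℚᵘ p ℚ.+ ℚ.fromℚᵘ q
  fromℚᵘ-+ p q = ℚ.toℚᵘ-injective (ℚᵘ.≃-trans (ℚ.toℚᵘ-fromℚᵘ (p ℚᵘ.+ q))
    (ℚᵘ.≃-sym (ℚᵘ.≃-trans (ℚ.toℚᵘ-homo-+ (ℚ.fromℚᵘ p) (ℚ.fromℚᵘ q))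
      (ℚᵘ.+-cong (ℚ.toℚᵘ-fromℚᵘ p) (ℚ.toℚᵘ-fromℚᵘ q)))))

  fromℚᵘ-* : ∀ p q → ℚ.fromℚᵘ (p ℚᵘ.* q) ≡ ℚ.fromℚᵘ p ℚ.* ℚ.fromℚᵘ q
  fromℚᵘ-* p q = ℚ.toℚᵘ-injective (ℚᵘ.≃-trans (ℚ.toℚᵘ-fromℚᵘ (p ℚᵘ.* q))
    (ℚᵘ.≃-sym (ℚᵘ.≃-trans (ℚ.toℚᵘ-homo-* (ℚ.fromℚᵘ p) (ℚ.fromℚᵘ q))
      (ℚᵘ.*-cong (ℚ.toℚᵘ-fromℚᵘ p) (ℚ.toℚᵘ-fromℚᵘ q)))))

  frac-suc : ∀ m d → + suc m ℚ./ suc d ≡ + m ℚ./ suc d ℚ.+ + 1 ℚ./ suc d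
  frac-suc m d = trans
    (ℚ.fromℚᵘ-cong {ℚᵘ.mkℚᵘ (+ suc m) d} {ℚᵘ.mkℚᵘ (+ m) d ℚᵘ.+ ℚᵘ.mkℚᵘ (+ 1) d}
      (ℚᵘ.*≡* (begin
        + suc m ℤ.* (+ suc d ℤ.* + suc d)
          ≡⟨ cong (ℤ._* (+ suc d ℤ.* + suc d)) (cong +_ (ℕ.+-comm 1 m)) ⟩
        (+ m ℤ.+ + 1) ℤ.* (+ suc d ℤ.* + suc d)
          ≡⟨ ℤ.*-assoc (+ m ℤ.+ + 1) (+ suc d) (+ suc d) ⟨
        (+ m ℤ.+ + 1) ℤ.* + suc d ℤ.* + suc d
          ≡⟨ cong (ℤ._* + suc d) (ℤ.*-distribʳ-+ (+ suc d) (+ m) (+ 1)) ⟩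
        (+ m ℤ.* + suc d ℤ.+ + 1 ℤ.* + suc d) ℤ.* + suc d ∎)))
    (fromℚᵘ-+ (ℚᵘ.mkℚᵘ (+ m) d) (ℚᵘ.mkℚᵘ (+ 1) d))
    where open ≡-Reasoning

  frac-* : ∀ m n d e → (+ m ℚ./ suc d) ℚ.* (+ n ℚ./ suc e) ≡ + (m ℕ.* n) ℚ./ (suc d ℕ.* suc e)
  frac-* m n d e = trans (sym (fromℚᵘ-* (ℚᵘ.mkℚᵘ (+ m) d) (ℚᵘ.mkℚᵘ (+ n) e)))
    (cong (λ z → z ℚ./ (suc d ℕ.* suc e)) (sym (ℤ.pos-* m n)))

  archimedean : ∀ ε → 0ℚ ℚ.< ε → ∃[ N ] (∀ i → N ℕ.≤ i → + 1 ℚ./ (2 ℕ.* suc i) ℚ.≤ ε)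
  archimedean (mkℚ +[1+ k ] d c) _ = d , λ i d≤i →
    subst (+ 1 ℚ./ (2 ℕ.* suc i) ℚ.≤_) (ℚ.fromℚᵘ-toℚᵘ (mkℚ +[1+ k ] d c))
      (frac-≤ {1} {suc k} {2 ℕ.* suc i} {suc d} (begin
        1 ℕ.* suc d              ≡⟨ ℕ.*-identityˡ (suc d) ⟩
        suc d                    ≤⟨ ℕ.s≤s d≤i ⟩
        suc i                    ≤⟨ ℕ.m≤n*m (suc i) 2 ⟩
        2 ℕ.* suc i              ≤⟨ ℕ.m≤n*m (2 ℕ.* suc i) (suc k) ⟩
        suc k ℕ.* (2 ℕ.* suc i)  ∎))
    where open ℕ.≤-Reasoning
  archimedean (mkℚ +0 d c) (ℚ.*<* (ℤ.+<+ ()))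
  archimedean (mkℚ -[1+ k ] d c) (ℚ.*<* ())

  ∣-∣≤ : ∀ {p q ε} → p ℚ.≤ q ℚ.+ ε → q ℚ.≤ p ℚ.+ ε → ℚ.∣ p ℚ.- q ∣ ℚ.≤ ε
  ∣-∣≤ {p} {q} {ε} p≤ q≤ with ℚ.∣p∣≡p∨∣p∣≡-p (p ℚ.- q)
  ... | inj₁ eq = subst₂ ℚ._≤_ (sym eq)
    (solve 2 (λ q ε → (q :+ ε) :- q := ε) refl q ε) (ℚ.+-monoˡ-≤ (ℚ.- q) p≤)
    where open ℚ.+-*-Solver
  ... | inj₂ eq = subst₂ ℚ._≤_
    (trans (solve 2 (λ p q → q :- p := :- (p :- q)) refl p q) (sym eq))
    (solve 2 (λ p ε → (p :+ ε) :- p := ε) refl p ε) (ℚ.+-monoˡ-≤ (ℚ.- p) q≤)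
    where open ℚ.+-*-Solver

  -- If p / 2a and q / 2b are the approximations of √½ by ⌊√(2a²)⌋ / 2a and
  -- ⌊√(2b²)⌋ / 2b, then p / 2a ≤ √½ ≤ (q + 1) / 2b.
  cross-≤ : ∀ p q i j → let a = suc i ; b = suc j in
            p ℕ.* p ℕ.≤ 2 ℕ.* (a ℕ.* a) → 2 ℕ.* (b ℕ.* b) ℕ.< suc q ℕ.* suc q →
            + p ℚ./ (2 ℕ.* a) ℚ.≤ + q ℚ./ (2 ℕ.* b) ℚ.+ + 1 ℚ./ (2 ℕ.* b)
  cross-≤ p q i j lo hi = subst (+ p ℚ./ (2 ℕ.* suc i) ℚ.≤_) (frac-suc q _)
    (frac-≤ {p} {suc q} {2 ℕ.* suc i} {2 ℕ.* suc j} (ℕ.≮⇒≥ λ gt →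
      ℕ.<-irrefl refl (contra p (suc q) (suc i) (suc j) lo (ℕ.<⇒≤ hi) gt)))
    where
    open ℕ.≤-Reasoning
    open ℕ.+-*-Solver
    sq : ∀ x y → (x ℕ.* y) ℕ.* (x ℕ.* y) ≡ (x ℕ.* x) ℕ.* (y ℕ.* y)
    sq = solve 2 (λ x y → (x :* y) :* (x :* y) := (x :* x) :* (y :* y)) refl
    contra : ∀ p q a b → p ℕ.* p ℕ.≤ 2 ℕ.* (a ℕ.* a) → 2 ℕ.* (b ℕ.* b) ℕ.≤ q ℕ.* q →
             q ℕ.* (2 ℕ.* a) ℕ.< p ℕ.* (2 ℕ.* b) →
             (p ℕ.* (2 ℕ.* b)) ℕ.* (p ℕ.* (2 ℕ.* b)) ℕ.< (p ℕ.* (2 ℕ.* b)) ℕ.* (p ℕ.* (2 ℕ.* b))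
    contra p q a b lo hi gt = begin-strict
      (p ℕ.* e) ℕ.* (p ℕ.* e)          ≡⟨ sq p e ⟩
      (p ℕ.* p) ℕ.* (e ℕ.* e)          ≤⟨ ℕ.*-monoˡ-≤ (e ℕ.* e) lo ⟩
      (2 ℕ.* (a ℕ.* a)) ℕ.* (e ℕ.* e)
        ≡⟨ solve 2 (λ a b → (con 2 :* (a :* a)) :* ((con 2 :* b) :* (con 2 :* b))
                   := (con 2 :* (b :* b)) :* ((con 2 :* a) :* (con 2 :* a))) refl a b ⟩
      (2 ℕ.* (b ℕ.* b)) ℕ.* (d ℕ.* d)  ≤⟨ ℕ.*-monoˡ-≤ (d ℕ.* d) hi ⟩
      (q ℕ.* q) ℕ.* (d ℕ.* d)          ≡⟨ sq q d ⟨
      (q ℕ.* d) ℕ.* (q ℕ.* d)          <⟨ ℕ.*-mono-< gt gt ⟩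
      (p ℕ.* e) ℕ.* (p ℕ.* e)          ∎
      where
      d = 2 ℕ.* a
      e = 2 ℕ.* b

  square-≤½ : ∀ p i → p ℕ.* p ℕ.≤ 2 ℕ.* (suc i ℕ.* suc i) →
              (+ p ℚ./ (2 ℕ.* suc i)) ℚ.* (+ p ℚ./ (2 ℕ.* suc i)) ℚ.≤ ½
  square-≤½ p i lo = subst (ℚ._≤ ½) (sym (frac-* p p _ _))
    (frac-≤ {p ℕ.* p} {1} {(2 ℕ.* suc i) ℕ.* (2 ℕ.* suc i)} {2}
      (ℕ.≤-trans (ℕ.*-monoˡ-≤ 2 lo) (ℕ.≤-reflexive (lemma (suc i)))))
    where
    open ℕ.+-*-Solver
    lemma : ∀ a → (2 ℕ.* (a ℕ.* a)) ℕ.* 2 ≡ 1 ℕ.* ((2 ℕ.* a) ℕ.* (2 ℕ.* a))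
    lemma = solve 1 (λ a → (con 2 :* (a :* a)) :* con 2
                        := con 1 :* ((con 2 :* a) :* (con 2 :* a))) refl

  ½-≤square : ∀ q i → 2 ℕ.* (suc i ℕ.* suc i) ℕ.< suc q ℕ.* suc q →
              let t = + q ℚ./ (2 ℕ.* suc i) ; u = + 1 ℚ./ (2 ℕ.* suc i) in
              ½ ℚ.≤ (t ℚ.+ u) ℚ.* (t ℚ.+ u)
  ½-≤square q i hi = subst (½ ℚ.≤_)
    (trans (sym (frac-* (suc q) (suc q) _ _)) (cong₂ ℚ._*_ (frac-suc q _) (frac-suc q _)))
    (frac-≤ {1} {suc q ℕ.* suc q} {2} {(2 ℕ.* suc i) ℕ.* (2 ℕ.* suc i)}
      (ℕ.≤-trans (ℕ.≤-reflexive (lemma (suc i))) (ℕ.*-monoˡ-≤ 2 (ℕ.<⇒≤ hi))))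
    where
    open ℕ.+-*-Solver
    lemma : ∀ a → 1 ℕ.* ((2 ℕ.* a) ℕ.* (2 ℕ.* a)) ≡ (2 ℕ.* (a ℕ.* a)) ℕ.* 2
    lemma = solve 1 (λ a → con 1 :* ((con 2 :* a) :* (con 2 :* a))
                        := (con 2 :* (a :* a)) :* con 2) refl

  r : ℕ → ℕ
  r i = isqrt (2 ℕ.* (suc i ℕ.* suc i))

  s : ℕ → ℚ
  s i = + r i ℚ./ (2 ℕ.* suc i)

  s-≤ : ∀ i j → s i ℚ.≤ s j ℚ.+ + 1 ℚ./ (2 ℕ.* suc j)
  s-≤ i j = cross-≤ (r i) (r j) i j (isqrt-lower (2 ℕ.* (suc i ℕ.* suc i)))
                            (isqrt-upper (2 ℕ.* (suc j ℕ.* suc j)))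

-- 2^{-1/2}, with i-th approximation ⌊√(2N²)⌋ / 2N for N = i + 1.
√½ : ℝ
√½ = mkℝ s λ ε 0<ε →
  let (N , small) = archimedean ε 0<ε in
  N , λ i j N≤i N≤j → ∣-∣≤
    (ℚ.≤-trans (s-≤ i j) (ℚ.+-monoʳ-≤ (s j) (small j N≤j)))
    (ℚ.≤-trans (s-≤ j i) (ℚ.+-monoʳ-≤ (s i) (small i N≤i)))

private
  s≥0 : ∀ i → 0ℚ ℚ.≤ s i
  s≥0 i = frac-≤ {0} {r i} {1} {2 ℕ.* suc i} ℕ.z≤n

  s²-≤½ : ∀ i → s i ℚ.* s i ℚ.≤ ½
  s²-≤½ i = square-≤½ (r i) i (isqrt-lower (2 ℕ.* (suc i ℕ.* suc i)))

  square-≤½⇒≤1 : ∀ t → 0ℚ ℚ.≤ t → t ℚ.* t ℚ.≤ ½ → t ℚ.≤ 1ℚ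
  square-≤½⇒≤1 t 0≤t t²≤½ with ℚ.≤-total t 1ℚ
  ... | inj₁ le = le
  ... | inj₂ ge with ℚ.≤-trans (*-mono-≤ {1ℚ} {t} {1ℚ} {t} (ℚ.nonNegative⁻¹ 1ℚ) 0≤t ge ge) t²≤½
  ... | ℚ.*≤* (ℤ.+≤+ (ℕ.s≤s ()))

  s≤1 : ∀ i → s i ℚ.≤ 1ℚ
  s≤1 i = square-≤½⇒≤1 (s i) (s≥0 i) (s²-≤½ i)

  ½-≤s² : ∀ i → let u = + 1 ℚ./ (2 ℕ.* suc i) in ½ ℚ.≤ (s i ℚ.+ u) ℚ.* (s i ℚ.+ u)
  ½-≤s² i = ½-≤square (r i) i (isqrt-upper (2 ℕ.* (suc i ℕ.* suc i)))

0≤√½ : 0ℝ ≤ℝ √½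
0≤√½ ε 0<ε = 0 , λ i _ →
  ℚ.≤-trans (s≥0 i) (ℚ.≤-trans (ℚ.≤-reflexive (sym (ℚ.+-identityʳ (s i))))
    (ℚ.+-monoʳ-≤ (s i) (ℚ.<⇒≤ 0<ε)))

√½-square : √½ *ℝ √½ ≃ℝ fromℚ ½
√½-square = upper , lower
  where
  upper : √½ *ℝ √½ ≤ℝ fromℚ ½
  upper ε 0<ε = 0 , λ i _ →
    ℚ.≤-trans (s²-≤½ i) (ℚ.≤-trans (ℚ.≤-reflexive (sym (ℚ.+-identityʳ ½)))
      (ℚ.+-monoʳ-≤ ½ (ℚ.<⇒≤ 0<ε)))

  ⅓ : ℚ
  ⅓ = + 1 ℚ./ 3

  estimate : ∀ t u ε → 0ℚ ℚ.≤ t → t ℚ.≤ 1ℚ → 0ℚ ℚ.≤ u → u ℚ.≤ 1ℚ → 0ℚ ℚ.≤ ε ℚ.* ⅓ →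
             u ℚ.≤ ε ℚ.* ⅓ → (t ℚ.+ u) ℚ.* (t ℚ.+ u) ℚ.≤ t ℚ.* t ℚ.+ ε
  estimate t u ε 0≤t t≤1 0≤u u≤1 0≤η u≤η = begin
    (t ℚ.+ u) ℚ.* (t ℚ.+ u)
      ≡⟨ solve 2 (λ t u → (t :+ u) :* (t :+ u) := t :* t :+ (t :+ t :+ u) :* u) refl t u ⟩
    t ℚ.* t ℚ.+ (t ℚ.+ t ℚ.+ u) ℚ.* u
      ≤⟨ ℚ.+-monoʳ-≤ (t ℚ.* t)
           (*-mono-≤ (ℚ.+-mono-≤ (ℚ.+-mono-≤ 0≤t 0≤t) 0≤u) 0≤η
             (ℚ.+-mono-≤ (ℚ.+-mono-≤ t≤1 t≤1) u≤1) u≤η) ⟩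
    t ℚ.* t ℚ.+ (1ℚ ℚ.+ 1ℚ ℚ.+ 1ℚ) ℚ.* (ε ℚ.* ⅓)
      ≡⟨ cong (t ℚ.* t ℚ.+_) (solve 1 (λ ε → con (+ 3 ℚ./ 1) :* (ε :* con ⅓) := ε) refl ε) ⟩
    t ℚ.* t ℚ.+ ε                            ∎
    where
    open ℚ.≤-Reasoning
    open ℚ.+-*-Solver

  lower : fromℚ ½ ≤ℝ √½ *ℝ √½
  lower ε 0<ε = N , λ i N≤i → ℚ.≤-trans (½-≤s² i)
    (estimate (s i) (+ 1 ℚ./ (2 ℕ.* suc i)) ε (s≥0 i) (s≤1 i)
      (frac-≤ {0} {1} {1} {2 ℕ.* suc i} ℕ.z≤n)
      (frac-≤ {1} {1} {2 ℕ.* suc i} {1} (ℕ.s≤s ℕ.z≤n))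
      (ℚ.<⇒≤ 0<η) (small i N≤i))
    where
    0<η : 0ℚ ℚ.< ε ℚ.* ⅓
    0<η = ℚ.positive⁻¹ (ε ℚ.* ⅓) {{ℚ.pos*pos⇒pos ε {{ℚ.positive 0<ε}} ⅓}}
    N = proj₁ (archimedean (ε ℚ.* ⅓) 0<η)
    small = proj₂ (archimedean (ε ℚ.* ⅓) 0<η)

comprehension : ∀ {n} {P : U.Pred (Fin n) 0ℓ} → U.Decidable P → Subset n
comprehension P? = tabulate (does ∘ P?)

image : ∀ {m n} → (Fin m → Fin n) → Subset m → Subset n
image φ S = comprehension (λ w → any? (λ v → (v ∈? S) ×-dec (φ v Fin.≟ w)))

subsets : ∀ n → List (Subset n)
subsets zero    = Vec.[] ∷ []
subsets (suc n) = map (inside Vec.∷_) (subsets n) ++ map (outside Vec.∷_) (subsets n)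

choose : ∀ {n} → Subset n → ℕ → List (Subset n)
choose {n} A k = filter (λ S → (S ⊆? A) ×-dec (∣ S ∣ ℕ.≟ k)) (subsets n)

-- V₁ = Fin m and V₂ = Fin k; all edges are oriented from V₁ to V₂.
record BipartiteDigraph (m k : ℕ) : Set₁ where
  infix 4 _⟶_ _⟶?_
  field
    _⟶_  : REL (Fin m) (Fin k) 0ℓ
    _⟶?_ : Decidable _⟶_

module _ {m k} (D : BipartiteDigraph m k) where
  open BipartiteDigraph D

  inNbrs : Fin k → Subset m
  inNbrs u = comprehension (λ v → v ⟶? u)

  outNbrs : Fin m → Subset k
  outNbrs v = comprehension (λ u → v ⟶? u)

  -- Vertices of V₁ have in-degree 0 and those of V₂ have out-degree 0, so
  -- they do not contribute to the respective maximum.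
  Δ⁻ : ℕ
  Δ⁻ = max 0 (map (λ u → ∣ inNbrs u ∣) (allFin k))

  Δ⁺ : ℕ
  Δ⁺ = max 0 (map (λ v → ∣ outNbrs v ∣) (allFin m))

-- Trichotomy: for u ≢ v exactly one of u ⟶ v and v ⟶ u holds, and never v ⟶ v.
record Tournament (n : ℕ) : Set₁ where
  infix 4 _⟶_
  field
    _⟶_     : Rel (Fin n) 0ℓ
    compare : Trichotomous _≡_ _⟶_

  infix 4 _⟶?_
  _⟶?_ : Decidable _⟶_
  _⟶?_ = tri⇒dec< compare

module _ {n} (T : Tournament n) where
  open Tournament T

  commonOutNbrs : Subset n → Subset n
  commonOutNbrs S = comprehension (λ w → all? (λ v → (v ∈? S) →-dec (v ⟶? w)))

  exceptional : Subset n → Subset n → ℕ → ℕ → List (Subset n)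
  exceptional A B k c =
    filter (λ S → ¬? (c ℕ.≤? ∣ commonOutNbrs S ∩ B ∣)) (choose A k)

module Submission where

-- Instead of the local lemma, count (after Rosenfeld). For S ⊆ V₁ let M(S) be the number of maps
-- V₁ → V(T) that are valid on S: φ(v) ∈ f(v) on S, φ is injective on S, and φ(N⁻(u)) is not
-- exceptional whenever N⁻(u) ⊆ S. The coordinates outside S are free, which only scales M(S).
-- Then, with n = |V(T)|, induction on |S| gives M(S ∪ {v}) ≥ (3b/4n) M(S) for v ∉ S. At least
-- (b − |S|)/n · M(S) maps valid on S send v into f(v) ∖ φ(S), and such a map fails on S ∪ {v} only
-- if some W = N⁻(u) ∋ v has an exceptional image. Such maps are valid on S ∖ W and injective but
-- exceptional on W. These two conditions are independent, M(S ∖ W) ≤ (4n/3b)^(|W|−1) M(S) by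
-- induction, and the second has probability at most δ (a/n)^|W| (for |W| < Δ⁻ because supersets of
-- exceptional sets are exceptional), so by the bound on δ each u costs
-- at most 3b/(16 Δ⁺ n) · M(S), where 2^(−1/2) is only used through 2^(−1/2) ≤ 3/4. The sum over the
-- at most Δ⁺ choices of u is 3b/16n · M(S), and 31/32 − 3/16 ≥ 3/4.

open import Defs
open import Data.Fin using (Fin; zero; suc)
import Data.Fin as Fin
open import Data.Fin.Properties using (any?; all?)
open import Data.Fin.Subset using (Subset; inside; outside; _∈_; _⊆_; ∣_∣; _∩_)
import Data.Fin.Subset as Subset
open import Data.Fin.Subset.Properties using (_∈?_; _⊆?_; ⊆-antisym; drop-there; s⊆s; ∈⊤; ∉⊥; ∣⊤∣≡n; ∣⊥∣≡0; ∣p∣≤n; p⊆q⇒∣p∣≤∣q∣; x∈p∩q⁺; x∈p∩q⁻)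
import Data.Integer as ℤ
import Data.Integer.Properties as ℤ
open import Data.List using (List; []; _∷_; _++_; map; filter; length; allFin; cartesianProductWith)
open import Data.List.Extrema.Nat using (xs≤max; argmax-sel)
open import Data.List.Membership.Propositional using () renaming (_∈_ to _∈ˡ_; _∉_ to _∉ˡ_)
import Data.List.Membership.DecPropositional as DecMembership
open import Data.List.Membership.Propositional.Properties using (∈-allFin; ∈-filter⁺; ∈-filter⁻; ∈-map⁺; ∈-map⁻; ∈-++⁺ˡ; ∈-++⁺ʳ; ∈-length)
open import Data.List.Properties using (map-tabulate; length-tabulate; length-map; map-cong-local; filter-all)
open import Data.List.Relation.Binary.Permutation.Propositional using (_↭_; ↭-refl; ↭-sym; ↭-trans; prep; ↭⇒↭ₛ)
import Data.List.Relation.Binary.Permutation.Propositional.Properties as ↭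
import Data.List.Relation.Binary.Permutation.Setoid.Properties as ↭ₛ
open import Data.List.Relation.Unary.All as All using (All; []; _∷_)
import Data.List.Relation.Unary.All.Properties as All
open import Data.List.Relation.Unary.AllPairs using ([]; _∷_)
import Data.List.Relation.Unary.AllPairs.Properties as AllPairs
open import Data.List.Relation.Unary.Any using (here; there)
open import Data.List.Relation.Unary.Unique.Propositional using (Unique)
import Data.List.Relation.Unary.Unique.DecPropositional as DecUnique
import Data.List.Relation.Unary.Unique.Propositional.Properties as Unique
open import Data.Nat hiding (_/_)
open import Data.Nat.Properties
open import Data.Nat.Solver using (module +-*-Solver)
open import Data.Product using (∃-syntax; _×_; _,_; proj₁; proj₂)
open import Data.Rational as ℚ using (ℚ; 0ℚ; 1ℚ; ½)
import Data.Rational.Properties as ℚ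
import Data.Rational.Solver as ℚ
import Data.Rational.Unnormalised as ℚᵘ
import Data.Rational.Unnormalised.Properties as ℚᵘ
open import Data.Sum using (_⊎_; inj₁; inj₂)
open import Data.Vec using (Vec; []; _∷_; lookup; _[_]≔_; here; there)
import Data.Vec.Properties as Vec
open import Function using (_∘_; id; case_of_)
open import Function.Definitions using (Injective)
open import Level using (0ℓ)
open import Relation.Binary.PropositionalEquality
open import Relation.Nullary using (Dec; yes; no; does; ¬_; contradiction)
open import Relation.Nullary.Decidable using (_×-dec_; _→-dec_; ¬?; dec-true; decidable-stable)
import Relation.Unary as U

private
  variable
    A B C : Set
    P Q R : Set
    k m n : ℕ

-- Finite sums and indicators

∑ : List A → (A → ℕ) → ℕ
∑ []       F = 0
∑ (x ∷ xs) F = F x + ∑ xs F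

module _ {F G : A → ℕ} where

  ∑-mono-∈ : ∀ xs → (∀ {x} → x ∈ˡ xs → F x ≤ G x) → ∑ xs F ≤ ∑ xs G
  ∑-mono-∈ []       F≤G = z≤n
  ∑-mono-∈ (x ∷ xs) F≤G = +-mono-≤ (F≤G (here refl)) (∑-mono-∈ xs (F≤G ∘ there))

  ∑-mono : ∀ xs → (∀ x → F x ≤ G x) → ∑ xs F ≤ ∑ xs G
  ∑-mono xs F≤G = ∑-mono-∈ xs (λ {x} _ → F≤G x)

  ∑-cong : ∀ xs → (∀ x → F x ≡ G x) → ∑ xs F ≡ ∑ xs G
  ∑-cong []       F≡G = refl
  ∑-cong (x ∷ xs) F≡G = cong₂ _+_ (F≡G x) (∑-cong xs F≡G)

  ∑-distrib-+ : ∀ xs → ∑ xs (λ x → F x + G x) ≡ ∑ xs F + ∑ xs G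
  ∑-distrib-+ []       = refl
  ∑-distrib-+ (x ∷ xs) rewrite ∑-distrib-+ xs =
    solve 4 (λ a b c d → (a :+ b) :+ (c :+ d) := (a :+ c) :+ (b :+ d)) refl (F x) (G x) _ _
    where open +-*-Solver

*-distribˡ-∑ : ∀ k xs (F : A → ℕ) → k * ∑ xs F ≡ ∑ xs (λ x → k * F x)
*-distribˡ-∑ k []       F = *-zeroʳ k
*-distribˡ-∑ k (x ∷ xs) F =
  trans (*-distribˡ-+ k (F x) _) (cong (k * F x +_) (*-distribˡ-∑ k xs F))

∑-const : ∀ (xs : List A) k → ∑ xs (λ _ → k) ≡ length xs * k
∑-const []       k = refl
∑-const (x ∷ xs) k = cong (k +_) (∑-const xs k)

∑-swap : ∀ (xs : List A) (ys : List B) (F : A → B → ℕ) →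
         ∑ xs (λ x → ∑ ys (λ y → F x y)) ≡ ∑ ys (λ y → ∑ xs (λ x → F x y))
∑-swap []       ys F = sym (trans (∑-const ys 0) (*-zeroʳ (length ys)))
∑-swap (x ∷ xs) ys F =
  trans (cong (∑ ys (F x) +_) (∑-swap xs ys F)) (sym (∑-distrib-+ ys))

∑-++ : ∀ (xs ys : List A) F → ∑ (xs ++ ys) F ≡ ∑ xs F + ∑ ys F
∑-++ []       ys F = refl
∑-++ (x ∷ xs) ys F = trans (cong (F x +_) (∑-++ xs ys F)) (sym (+-assoc (F x) _ _))

∑-map : ∀ (f : A → B) xs F → ∑ (map f xs) F ≡ ∑ xs (F ∘ f)
∑-map f []       F = refl
∑-map f (x ∷ xs) F = cong (F (f x) +_) (∑-map f xs F)

∑-cartesianProductWith : ∀ (f : A → B → C) xs ys F →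
  ∑ (cartesianProductWith f xs ys) F ≡ ∑ xs (λ x → ∑ ys (λ y → F (f x y)))
∑-cartesianProductWith f []       ys F = refl
∑-cartesianProductWith f (x ∷ xs) ys F =
  trans (∑-++ (map (f x) ys) _ F) (cong₂ _+_ (∑-map (f x) ys F) (∑-cartesianProductWith f xs ys F))

∑-allFin-suc : ∀ (F : Fin (suc n) → ℕ) → ∑ (allFin (suc n)) F ≡ F zero + ∑ (allFin n) (F ∘ suc)
∑-allFin-suc F = cong (F zero +_)
  (trans (cong (λ xs → ∑ xs F) (sym (map-tabulate id suc))) (∑-map suc (allFin _) F))

≤∑ : ∀ {xs} {x : A} (F : A → ℕ) → x ∈ˡ xs → F x ≤ ∑ xs F
≤∑ F (here refl) = m≤m+n _ _
≤∑ F (there x∈)  = ≤-trans (≤∑ F x∈) (m≤n+m _ _)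

∑>0⇒∃ : ∀ (xs : List A) F → 0 < ∑ xs F → ∃[ x ] 0 < F x
∑>0⇒∃ (x ∷ xs) F 0<∑ with F x in eq
... | suc _ = x , subst (0 <_) (sym eq) z<s
... | zero  = ∑>0⇒∃ xs F 0<∑

𝟙 : Dec P → ℕ
𝟙 (yes _) = 1
𝟙 (no  _) = 0

𝟙-yes : (p? : Dec P) → P → 𝟙 p? ≡ 1
𝟙-yes (yes _) p = refl
𝟙-yes (no ¬p) p = contradiction p ¬p

𝟙-no : (p? : Dec P) → ¬ P → 𝟙 p? ≡ 0
𝟙-no (yes p) ¬p = contradiction p ¬p
𝟙-no (no _)  ¬p = refl

𝟙>0 : (p? : Dec P) → 0 < 𝟙 p? → P
𝟙>0 (yes p) _ = p

𝟙*-≤ : ∀ {j k} (p? : Dec P) → (P → j ≤ k) → j * 𝟙 p? ≤ k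
𝟙*-≤ {j = j} {k} (yes p) j≤k = subst (_≤ k) (sym (*-identityʳ j)) (j≤k p)
𝟙*-≤ {j = j} {k} (no _)  _   = subst (_≤ k) (sym (*-zeroʳ j)) z≤n

𝟙-≤ : ∀ {k} (p? : Dec P) → (P → 1 ≤ k) → 𝟙 p? ≤ k
𝟙-≤ (yes p) 1≤k = 1≤k p
𝟙-≤ (no _)  _   = z≤n

𝟙-mono : (p? : Dec P) (q? : Dec Q) → (P → Q) → 𝟙 p? ≤ 𝟙 q?
𝟙-mono p? q? p⇒q = 𝟙-≤ p? λ p → ≤-reflexive (sym (𝟙-yes q? (p⇒q p)))

𝟙-cong : (p? : Dec P) (q? : Dec Q) → (P → Q) → (Q → P) → 𝟙 p? ≡ 𝟙 q?
𝟙-cong p? q? p⇒q q⇒p = ≤-antisym (𝟙-mono p? q? p⇒q) (𝟙-mono q? p? q⇒p)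

𝟙-× : (p? : Dec P) (q? : Dec Q) → 𝟙 (p? ×-dec q?) ≡ 𝟙 p? * 𝟙 q?
𝟙-× (yes _) (yes _) = refl
𝟙-× (yes _) (no _)  = refl
𝟙-× (no _)  _       = refl

𝟙-split : (p? : Dec P) (q? : Dec Q) (r? : Dec R) → (P → Q ⊎ R) → 𝟙 p? ≤ 𝟙 q? + 𝟙 r?
𝟙-split (no _)  _  _  _     = z≤n
𝟙-split (yes p) q? r? p⇒q∨r with p⇒q∨r p
... | inj₁ q = ≤-trans (≤-reflexive (sym (𝟙-yes q? q))) (m≤m+n _ _)
... | inj₂ r = ≤-trans (≤-reflexive (sym (𝟙-yes r? r))) (m≤n+m _ _)

𝟙-disjoint : (p? : Dec P) (q? : Dec Q) (r? : Dec R) →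
             (P → R) → (Q → R) → (P → ¬ Q) → 𝟙 p? + 𝟙 q? ≤ 𝟙 r?
𝟙-disjoint (yes p) (yes q) _  _   _   p⇒¬q = contradiction q (p⇒¬q p)
𝟙-disjoint (yes p) (no _)  r? p⇒r _   _    = ≤-reflexive (sym (𝟙-yes r? (p⇒r p)))
𝟙-disjoint (no _)  q?      r? _   q⇒r _    = 𝟙-mono q? r? q⇒r

module _ {P : U.Pred A 0ℓ} (P? : U.Decidable P) where

  ∑𝟙≡0 : ∀ xs → (∀ {x} → x ∈ˡ xs → ¬ P x) → ∑ xs (𝟙 ∘ P?) ≡ 0
  ∑𝟙≡0 []       _  = refl
  ∑𝟙≡0 (x ∷ xs) ¬P = cong₂ _+_ (𝟙-no (P? x) (¬P (here refl))) (∑𝟙≡0 xs (¬P ∘ there))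

  ∑𝟙≤1 : ∀ {xs} → Unique xs → (∀ {x y} → P x → P y → x ≡ y) → ∑ xs (𝟙 ∘ P?) ≤ 1
  ∑𝟙≤1 []                       _    = z≤n
  ∑𝟙≤1 {x ∷ xs} (x∉xs ∷ unique) same with P? x
  ... | yes px = ≤-reflexive (cong suc (∑𝟙≡0 xs λ y∈xs py → All.lookup x∉xs y∈xs (same px py)))
  ... | no _   = ∑𝟙≤1 unique same

vectors : List A → ∀ m → List (Vec A m)
vectors xs zero    = [] ∷ []
vectors xs (suc m) = cartesianProductWith _∷_ xs (vectors xs m)

∑-vectors-suc : ∀ (xs : List A) (F : Vec A (suc m) → ℕ) →
  ∑ (vectors xs (suc m)) F ≡ ∑ xs (λ x → ∑ (vectors xs m) (λ φ → F (x ∷ φ)))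
∑-vectors-suc xs = ∑-cartesianProductWith _∷_ xs (vectors xs _)

∑-vectors-1 : ∀ (xs : List A) m → ∑ (vectors xs m) (λ _ → 1) ≡ length xs ^ m
∑-vectors-1 xs zero    = refl
∑-vectors-1 xs (suc m) = trans (∑-vectors-suc xs (λ _ → 1))
  (trans (∑-cong xs (λ _ → ∑-vectors-1 xs m)) (∑-const xs _))

∑-resample : ∀ (xs : List A) (v : Fin m) F →
  ∑ (vectors xs m) (λ φ → ∑ xs (λ x → F (φ [ v ]≔ x))) ≡ length xs * ∑ (vectors xs m) F
∑-resample {m = suc m} xs zero F = begin
  ∑ (vectors xs (suc m)) (λ φ → ∑ xs (λ x → F (φ [ zero ]≔ x)))
    ≡⟨ ∑-vectors-suc xs _ ⟩
  ∑ xs (λ _ → ∑ (vectors xs m) (λ φ → ∑ xs (λ x → F (x ∷ φ))))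
    ≡⟨ ∑-const xs _ ⟩
  length xs * ∑ (vectors xs m) (λ φ → ∑ xs (λ x → F (x ∷ φ)))
    ≡⟨ cong (length xs *_) (∑-swap (vectors xs m) xs (λ φ x → F (x ∷ φ))) ⟩
  length xs * ∑ xs (λ x → ∑ (vectors xs m) (λ φ → F (x ∷ φ)))
    ≡⟨ cong (length xs *_) (∑-vectors-suc xs F) ⟨
  length xs * ∑ (vectors xs (suc m)) F ∎
  where open ≡-Reasoning
∑-resample {m = suc m} xs (suc v) F = begin
  ∑ (vectors xs (suc m)) (λ φ → ∑ xs (λ x → F (φ [ suc v ]≔ x)))
    ≡⟨ ∑-vectors-suc xs _ ⟩
  ∑ xs (λ y → ∑ (vectors xs m) (λ φ → ∑ xs (λ x → F (y ∷ (φ [ v ]≔ x)))))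
    ≡⟨ ∑-cong xs (λ y → ∑-resample xs v (λ φ → F (y ∷ φ))) ⟩
  ∑ xs (λ y → length xs * ∑ (vectors xs m) (λ φ → F (y ∷ φ)))
    ≡⟨ *-distribˡ-∑ (length xs) xs _ ⟨
  length xs * ∑ xs (λ y → ∑ (vectors xs m) (λ φ → F (y ∷ φ)))
    ≡⟨ cong (length xs *_) (∑-vectors-suc xs F) ⟨
  length xs * ∑ (vectors xs (suc m)) F ∎
  where open ≡-Reasoning

DependsOn : ∀ {m} → U.Pred (Fin m) 0ℓ → (Vec A m → ℕ) → Set
DependsOn I F = ∀ φ ψ → (∀ {i} → I i → lookup φ i ≡ lookup ψ i) → F φ ≡ F ψ

∑-∷-const : ∀ {I : U.Pred (Fin (suc m)) 0ℓ} {F : Vec A (suc m) → ℕ} → DependsOn I F →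
            ¬ I zero → ∀ xs x y →
            ∑ (vectors xs m) (λ φ → F (x ∷ φ)) ≡ ∑ (vectors xs m) (λ φ → F (y ∷ φ))
∑-∷-const dep 0∉I xs x y = ∑-cong (vectors xs _) λ φ → dep (x ∷ φ) (y ∷ φ)
  λ { {zero} 0∈I → contradiction 0∈I 0∉I ; {suc i} _ → refl }

dependsOn-∷ : ∀ {I : U.Pred (Fin (suc m)) 0ℓ} {F : Vec A (suc m) → ℕ} → DependsOn I F →
              ∀ x → DependsOn (I ∘ suc) (F ∘ (x ∷_))
dependsOn-∷ dep x φ ψ φ≗ψ = dep (x ∷ φ) (x ∷ ψ) λ { {zero} _ → refl ; {suc i} → φ≗ψ }

∑*∑-constʳ : ∀ (xs : List A) (F G : A → ℕ) → (∀ x y → G x ≡ G y) →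
             ∑ xs F * ∑ xs G ≡ length xs * ∑ xs (λ x → F x * G x)
∑*∑-constʳ [] F G const = refl
∑*∑-constʳ xs@(x ∷ _) F G const = begin
  ∑ xs F * ∑ xs G                       ≡⟨ cong (∑ xs F *_) (∑-cong xs (λ y → const y x)) ⟩
  ∑ xs F * ∑ xs (λ _ → G x)             ≡⟨ cong (∑ xs F *_) (∑-const xs (G x)) ⟩
  ∑ xs F * (length xs * G x)            ≡⟨ solve 3 (λ s l g → s :* (l :* g) := l :* (g :* s)) refl (∑ xs F) (length xs) (G x) ⟩
  length xs * (G x * ∑ xs F)            ≡⟨ cong (length xs *_) (*-distribˡ-∑ (G x) xs F) ⟩
  length xs * ∑ xs (λ y → G x * F y)
    ≡⟨ cong (length xs *_) (∑-cong xs (λ y → trans (*-comm (G x) (F y)) (cong (F y *_) (const x y)))) ⟩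
  length xs * ∑ xs (λ y → F y * G y)    ∎
  where
  open ≡-Reasoning
  open +-*-Solver

∑-independent : ∀ (xs : List A) {m} {I J : U.Pred (Fin m) 0ℓ} → U.Decidable I →
  (∀ {i} → I i → ¬ J i) → ∀ {F G} → DependsOn I F → DependsOn J G →
  ∑ (vectors xs m) F * ∑ (vectors xs m) G ≡ length xs ^ m * ∑ (vectors xs m) (λ φ → F φ * G φ)
∑-independent xs {zero} I? disjoint {F} {G} depF depG =
  solve 2 (λ f g → (f :+ con 0) :* (g :+ con 0) := con 1 :* (f :* g :+ con 0)) refl (F []) (G [])
  where open +-*-Solver
∑-independent xs {suc m} {I} {J} I? disjoint {F} {G} depF depG = begin
  ∑ (vectors xs (suc m)) F * ∑ (vectors xs (suc m)) G
    ≡⟨ cong₂ _*_ (∑-vectors-suc xs F) (∑-vectors-suc xs G) ⟩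
  ∑ xs F′ * ∑ xs G′
    ≡⟨ first (I? zero) ⟩
  length xs * ∑ xs (λ x → F′ x * G′ x)
    ≡⟨ cong (length xs *_) (∑-cong xs λ x → ∑-independent xs (I? ∘ suc) disjoint
         (dependsOn-∷ depF x) (dependsOn-∷ depG x)) ⟩
  length xs * ∑ xs (λ x → length xs ^ m * ∑ (vectors xs m) (λ φ → F (x ∷ φ) * G (x ∷ φ)))
    ≡⟨ cong (length xs *_) (*-distribˡ-∑ (length xs ^ m) xs _) ⟨
  length xs * (length xs ^ m * ∑ xs (λ x → ∑ (vectors xs m) (λ φ → F (x ∷ φ) * G (x ∷ φ))))
    ≡⟨ *-assoc (length xs) (length xs ^ m) _ ⟨
  length xs ^ suc m * ∑ xs (λ x → ∑ (vectors xs m) (λ φ → F (x ∷ φ) * G (x ∷ φ)))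
    ≡⟨ cong (length xs ^ suc m *_) (∑-vectors-suc xs (λ φ → F φ * G φ)) ⟨
  length xs ^ suc m * ∑ (vectors xs (suc m)) (λ φ → F φ * G φ) ∎
  where
  open ≡-Reasoning
  F′ G′ : _ → ℕ
  F′ x = ∑ (vectors xs m) (λ φ → F (x ∷ φ))
  G′ x = ∑ (vectors xs m) (λ φ → G (x ∷ φ))
  first : Dec (I zero) → ∑ xs F′ * ∑ xs G′ ≡ length xs * ∑ xs (λ x → F′ x * G′ x)
  first (yes 0∈I) = ∑*∑-constʳ xs F′ G′ (∑-∷-const depG (disjoint 0∈I) xs)
  first (no 0∉I)  = trans (*-comm (∑ xs F′) (∑ xs G′)) (trans
    (∑*∑-constʳ xs G′ F′ (∑-∷-const depF 0∉I xs))
    (cong (length xs *_) (∑-cong xs (λ x → *-comm (G′ x) (F′ x)))))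

_∈ˡ?_ : (x : Fin n) (xs : List (Fin n)) → Dec (x ∈ˡ xs)
_∈ˡ?_ = DecMembership._∈?_ Fin._≟_

∑-𝟙-≡ : ∀ (y : Fin n) → ∑ (allFin n) (λ x → 𝟙 (x Fin.≟ y)) ≡ 1
∑-𝟙-≡ {n} y = ≤-antisym
  (∑𝟙≤1 (Fin._≟ y) (Unique.allFin⁺ n) (λ x≡y z≡y → trans x≡y (sym z≡y)))
  (≤-trans (≤-reflexive (sym (𝟙-yes (y Fin.≟ y) refl))) (≤∑ (λ x → 𝟙 (x Fin.≟ y)) (∈-allFin y)))

∑-𝟙-∈ : ∀ (p : Subset n) → ∑ (allFin n) (λ x → 𝟙 (x ∈? p)) ≡ ∣ p ∣
∑-𝟙-∈ []      = refl
∑-𝟙-∈ {suc n} (s ∷ p) = trans (∑-allFin-suc (λ x → 𝟙 (x ∈? (s ∷ p))))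
  (trans (cong (𝟙 (zero ∈? (s ∷ p)) +_) (trans
    (∑-cong (allFin n) (λ x → 𝟙-cong (suc x ∈? (s ∷ p)) (x ∈? p) drop-there there)) (∑-𝟙-∈ p)))
  (head s))
  where
  head : ∀ s → 𝟙 (zero ∈? (s ∷ p)) + ∣ p ∣ ≡ ∣ s ∷ p ∣
  head inside  = refl
  head outside = refl

module _ (p : Subset n) where

  fresh? : (L : List (Fin n)) → U.Decidable (λ x → x ∈ p × x ∉ˡ L)
  fresh? L x = (x ∈? p) ×-dec ¬? (x ∈ˡ? L)

  #fresh : List (Fin n) → ℕ
  #fresh L = ∑ (allFin n) (𝟙 ∘ fresh? L)

  #fresh-[] : #fresh [] ≡ ∣ p ∣
  #fresh-[] = trans
    (∑-cong (allFin n) λ x → 𝟙-cong (fresh? [] x) (x ∈? p) proj₁ (_, λ ()))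
    (∑-𝟙-∈ p)

  #fresh-lower : ∀ L → ∣ p ∣ ≤ #fresh L + length L
  #fresh-lower []      = ≤-reflexive (sym (trans (+-identityʳ _) #fresh-[]))
  #fresh-lower (y ∷ L) = begin
    ∣ p ∣                      ≤⟨ #fresh-lower L ⟩
    #fresh L + length L        ≤⟨ +-monoˡ-≤ (length L) step ⟩
    #fresh (y ∷ L) + 1 + length L  ≡⟨ +-assoc (#fresh (y ∷ L)) 1 (length L) ⟩
    #fresh (y ∷ L) + suc (length L) ∎
    where
    open ≤-Reasoning
    pointwise : ∀ x → 𝟙 (fresh? L x) ≤ 𝟙 (fresh? (y ∷ L) x) + 𝟙 (x Fin.≟ y)
    pointwise x = 𝟙-split (fresh? L x) (fresh? (y ∷ L) x) (x Fin.≟ y) λ (x∈p , x∉L) →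
      case x Fin.≟ y of λ where
        (yes x≡y) → inj₂ x≡y
        (no x≢y)  → inj₁ (x∈p , λ { (here x≡y) → x≢y x≡y ; (there x∈L) → x∉L x∈L })
    step : #fresh L ≤ #fresh (y ∷ L) + 1
    step = ≤-trans (∑-mono (allFin n) pointwise) (≤-reflexive
      (trans (∑-distrib-+ (allFin n)) (cong (#fresh (y ∷ L) +_) (∑-𝟙-≡ y))))

  #fresh-upper : ∀ {L} → Unique L → All (_∈ p) L → #fresh L + length L ≤ ∣ p ∣
  #fresh-upper []                        []          = ≤-reflexive (trans (+-identityʳ _) #fresh-[])
  #fresh-upper {y ∷ L} (y∉L ∷ unique) (y∈p ∷ L⊆p) = begin
    #fresh (y ∷ L) + suc (length L)   ≡⟨ +-assoc (#fresh (y ∷ L)) 1 (length L) ⟨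
    #fresh (y ∷ L) + 1 + length L     ≤⟨ +-monoˡ-≤ (length L) step ⟩
    #fresh L + length L               ≤⟨ #fresh-upper unique L⊆p ⟩
    ∣ p ∣                             ∎
    where
    open ≤-Reasoning
    step : #fresh (y ∷ L) + 1 ≤ #fresh L
    step = ≤-trans (≤-reflexive (sym
      (trans (∑-distrib-+ (allFin n)) (cong (#fresh (y ∷ L) +_) (∑-𝟙-≡ y)))))
      (∑-mono (allFin n) λ x → 𝟙-disjoint (fresh? (y ∷ L) x) (x Fin.≟ y) (fresh? L x)
        (λ (x∈p , x∉yL) → x∈p , x∉yL ∘ there)
        (λ { refl → y∈p , λ y∈L → All.lookup y∉L y∈L refl })
        (λ { (_ , x∉yL) x≡y → x∉yL (here x≡y) }))

  #fresh-exact : ∀ {L} → Unique L → All (_∈ p) L → #fresh L + length L ≡ ∣ p ∣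
  #fresh-exact {L} unique L⊆p = ≤-antisym (#fresh-upper unique L⊆p) (#fresh-lower L)

  length≤ : ∀ {L} → Unique L → All (_∈ p) L → length L ≤ ∣ p ∣
  length≤ unique L⊆p = ≤-trans (m≤n+m _ _) (#fresh-upper unique L⊆p)

  exhausts : ∀ {L} → Unique L → All (_∈ p) L → length L ≡ ∣ p ∣ → ∀ {x} → x ∈ p → x ∈ˡ L
  exhausts {L} unique L⊆p full {x} x∈p with x ∈ˡ? L
  ... | yes x∈L = x∈L
  ... | no x∉L  = contradiction full (<⇒≢ (begin-strict
    length L              <⟨ n<1+n _ ⟩
    1 + length L          ≤⟨ +-monoˡ-≤ (length L) (≤-trans
                               (≤-reflexive (sym (𝟙-yes (fresh? L x) (x∈p , x∉L))))
                               (≤∑ (𝟙 ∘ fresh? L) (∈-allFin x))) ⟩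
    #fresh L + length L   ≤⟨ #fresh-upper unique L⊆p ⟩
    ∣ p ∣                 ∎))
    where open ≤-Reasoning

-- Maps between finite sets and exceptional images

∈-comprehension⁺ : ∀ {P : U.Pred (Fin n) 0ℓ} (P? : U.Decidable P) {x} → P x → x ∈ comprehension P?
∈-comprehension⁺ P? {x} px = Vec.lookup⇒[]= x _
  (trans (Vec.lookup∘tabulate (does ∘ P?) x) (dec-true (P? x) px))

∈-comprehension⁻ : ∀ {P : U.Pred (Fin n) 0ℓ} (P? : U.Decidable P) {x} → x ∈ comprehension P? → P x
∈-comprehension⁻ P? {x} x∈ with P? x | trans (sym (Vec.lookup∘tabulate (does ∘ P?) x)) (Vec.[]=⇒lookup x∈)
... | yes px | _ = px

setOf : List (Fin n) → Subset n
setOf L = comprehension (_∈ˡ? L)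

∈-setOf⁺ : ∀ {L : List (Fin n)} {x} → x ∈ˡ L → x ∈ setOf L
∈-setOf⁺ {L = L} = ∈-comprehension⁺ (_∈ˡ? L)

∈-setOf⁻ : ∀ {L : List (Fin n)} {x} → x ∈ setOf L → x ∈ˡ L
∈-setOf⁻ {L = L} = ∈-comprehension⁻ (_∈ˡ? L)

∣setOf∣ : ∀ {L : List (Fin n)} → Unique L → ∣ setOf L ∣ ≡ length L
∣setOf∣ {n} {L} unique = sym (trans
  (cong (_+ length L) (sym (∑𝟙≡0 (fresh? (setOf L) L) (allFin n) λ _ (x∈ , x∉) → x∉ (∈-setOf⁻ x∈))))
  (#fresh-exact (setOf L) unique (All.tabulate ∈-setOf⁺)))

∈-subsets : ∀ (p : Subset n) → p ∈ˡ subsets n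
∈-subsets []            = here refl
∈-subsets (inside  ∷ p) = ∈-++⁺ˡ (∈-map⁺ (inside ∷_) (∈-subsets p))
∈-subsets (outside ∷ p) = ∈-++⁺ʳ _ (∈-map⁺ (outside ∷_) (∈-subsets p))

subsets-unique : ∀ n → Unique (subsets n)
subsets-unique zero    = [] ∷ []
subsets-unique (suc n) = Unique.++⁺
  (Unique.map⁺ Vec.∷-injectiveʳ (subsets-unique n))
  (Unique.map⁺ Vec.∷-injectiveʳ (subsets-unique n))
  λ (p∈ , q∈) → case ∈-map⁻ (inside ∷_) p∈ , ∈-map⁻ (outside ∷_) q∈ of
    λ { ((_ , _ , refl) , (_ , _ , ())) }

module _ (A : Subset n) (k : ℕ) where

  ∈-choose⁺ : ∀ {S} → S ⊆ A → ∣ S ∣ ≡ k → S ∈ˡ choose A k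
  ∈-choose⁺ {S} S⊆A ∣S∣≡k = ∈-filter⁺ (λ S → (S ⊆? A) ×-dec (∣ S ∣ ≟ k)) (∈-subsets S) (S⊆A , ∣S∣≡k)

  ∈-choose⁻ : ∀ {S} → S ∈ˡ choose A k → S ⊆ A × ∣ S ∣ ≡ k
  ∈-choose⁻ = proj₂ ∘ ∈-filter⁻ (λ S → (S ⊆? A) ×-dec (∣ S ∣ ≟ k)) {xs = subsets n}

  choose-unique : Unique (choose A k)
  choose-unique = Unique.filter⁺ (λ S → (S ⊆? A) ×-dec (∣ S ∣ ≟ k)) (subsets-unique n)

∃-subset-of-size : ∀ (A : Subset n) k → k ≤ ∣ A ∣ → ∃[ S ] S ⊆ A × ∣ S ∣ ≡ k
∃-subset-of-size [] zero z≤n = [] , id , refl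
∃-subset-of-size (outside ∷ A) k k≤ = let (S , S⊆A , ∣S∣≡k) = ∃-subset-of-size A k k≤ in
  outside ∷ S , s⊆s S⊆A , ∣S∣≡k
∃-subset-of-size {suc n} (inside ∷ A) zero k≤ =
  Subset.⊥ , (λ x∈⊥ → contradiction x∈⊥ ∉⊥) , ∣⊥∣≡0 (suc n)
∃-subset-of-size (inside ∷ A) (suc k) (s≤s k≤) = let (S , S⊆A , ∣S∣≡k) = ∃-subset-of-size A k k≤ in
  inside ∷ S , s⊆s S⊆A , cong suc ∣S∣≡k

values : ∀ {A : Set} → Vec A m → List (Fin m) → List A
values φ = map (lookup φ)

values-cong : ∀ {A : Set} {φ ψ : Vec A m} {W} → (∀ {i} → i ∈ˡ W → lookup φ i ≡ lookup ψ i) →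
              values φ W ≡ values ψ W
values-cong φ≗ψ = map-cong-local (All.tabulate φ≗ψ)

lookup-update-∉ : ∀ {A : Set} (φ : Vec A m) {w W} x → w ∉ˡ W → ∀ {i} → i ∈ˡ W →
                  lookup (φ [ w ]≔ x) i ≡ lookup φ i
lookup-update-∉ φ x w∉W i∈W = Vec.lookup∘update′ (λ { refl → w∉W i∈W }) φ x

values-update : ∀ {A : Set} (φ : Vec A m) {w W} x → w ∉ˡ W →
                values (φ [ w ]≔ x) (w ∷ W) ≡ x ∷ values φ W
values-update φ {w} x w∉W =
  cong₂ _∷_ (Vec.lookup∘update w φ x) (values-cong {φ = φ [ w ]≔ x} {φ} (lookup-update-∉ φ x w∉W))

maps : ∀ m n → List (Vec (Fin n) m)
maps m n = vectors (allFin n) m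

length-allFin : ∀ n → length (allFin n) ≡ n
length-allFin n = length-tabulate {n = n} id

maps-resample : ∀ (v : Fin m) (F : Vec (Fin n) m → ℕ) →
  ∑ (maps m n) (λ φ → ∑ (allFin n) (λ x → F (φ [ v ]≔ x))) ≡ n * ∑ (maps m n) F
maps-resample {n = n} v F =
  trans (∑-resample (allFin n) v F) (cong (_* ∑ (maps _ n) F) (length-allFin n))

∑-maps-1 : ∀ m n → ∑ (maps m n) (λ _ → 1) ≡ n ^ m
∑-maps-1 m n = trans (∑-vectors-1 (allFin n) m) (cong (_^ m) (length-allFin n))

maps-independent : ∀ {I J : U.Pred (Fin m) 0ℓ} → U.Decidable I → (∀ {i} → I i → ¬ J i) →
  ∀ {F G : Vec (Fin n) m → ℕ} → DependsOn I F → DependsOn J G →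
  ∑ (maps m n) F * ∑ (maps m n) G ≡ n ^ m * ∑ (maps m n) (λ φ → F φ * G φ)
maps-independent {m} {n} I? disjoint {F} {G} depF depG =
  trans (∑-independent (allFin n) I? disjoint depF depG)
    (cong (λ l → l ^ m * ∑ (maps m n) (λ φ → F φ * G φ)) (length-allFin n))

module Injections {n} (A : Subset n) where

  Fits : List (Fin n) → Set
  Fits L = Unique L × All (_∈ A) L

  fits? : U.Decidable Fits
  fits? L = DecUnique.unique? Fin._≟_ L ×-dec All.all? (_∈? A) L

  fits-∷ : ∀ {x L} → Fits L → x ∈ A × x ∉ˡ L → Fits (x ∷ L)
  fits-∷ {x} {L} (unique , L⊆A) (x∈A , x∉L) =
    All.tabulate (λ { y∈L refl → x∉L y∈L }) ∷ unique , x∈A ∷ L⊆A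

  fits-head : ∀ {x L} → Fits (x ∷ L) → x ∈ A × x ∉ˡ L
  fits-head (x∉L ∷ _ , x∈A ∷ _) = x∈A , λ x∈L → All.lookup x∉L x∈L refl

  fits-tail : ∀ {x L} → Fits (x ∷ L) → Fits L
  fits-tail (_ ∷ unique , _ ∷ L⊆A) = unique , L⊆A

  #inj : List (Fin m) → ℕ
  #inj {m} W = ∑ (maps m n) (λ φ → 𝟙 (fits? (values φ W)))

  #inj-∷ : ∀ {w : Fin m} {W} → w ∉ˡ W → n * #inj (w ∷ W) + length W * #inj W ≡ ∣ A ∣ * #inj W
  #inj-∷ {m} {w} {W} w∉W = begin
    n * #inj (w ∷ W) + length W * #inj W
      ≡⟨ cong₂ _+_ (trans (sym (maps-resample w _))
           (∑-cong (maps m n) λ φ → ∑-cong (allFin n) λ x → cong (𝟙 ∘ fits?) (values-update φ x w∉W)))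
           (*-distribˡ-∑ (length W) (maps m n) _) ⟩
    ∑ (maps m n) (λ φ → ∑ (allFin n) (λ x → 𝟙 (fits? (x ∷ values φ W)))) +
    ∑ (maps m n) (λ φ → length W * 𝟙 (fits? (values φ W)))
      ≡⟨ ∑-distrib-+ (maps m n) ⟨
    ∑ (maps m n) (λ φ → ∑ (allFin n) (λ x → 𝟙 (fits? (x ∷ values φ W))) + length W * 𝟙 (fits? (values φ W)))
      ≡⟨ ∑-cong (maps m n) (λ φ → trans
           (cong (λ l → ∑ (allFin n) (λ x → 𝟙 (fits? (x ∷ values φ W))) + l * 𝟙 (fits? (values φ W)))
             (sym (length-map (lookup φ) W)))
           (pointwise (values φ W) (fits? (values φ W)))) ⟩
    ∑ (maps m n) (λ φ → ∣ A ∣ * 𝟙 (fits? (values φ W)))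
      ≡⟨ *-distribˡ-∑ ∣ A ∣ (maps m n) _ ⟨
    ∣ A ∣ * #inj W ∎
    where
    open ≡-Reasoning
    pointwise : ∀ L (d : Dec (Fits L)) →
      ∑ (allFin n) (λ x → 𝟙 (fits? (x ∷ L))) + length L * 𝟙 d ≡ ∣ A ∣ * 𝟙 d
    pointwise L (yes fits@(unique , L⊆A)) = begin
      ∑ (allFin n) (λ x → 𝟙 (fits? (x ∷ L))) + length L * 1
        ≡⟨ cong₂ _+_ (∑-cong (allFin n) λ x → 𝟙-cong (fits? (x ∷ L)) (fresh? A L x) fits-head (fits-∷ fits))
             (*-identityʳ (length L)) ⟩
      #fresh A L + length L   ≡⟨ #fresh-exact A unique L⊆A ⟩
      ∣ A ∣                   ≡⟨ *-identityʳ ∣ A ∣ ⟨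
      ∣ A ∣ * 1               ∎
    pointwise L (no ¬fits) = begin
      ∑ (allFin n) (λ x → 𝟙 (fits? (x ∷ L))) + length L * 0
        ≡⟨ cong₂ _+_ (∑𝟙≡0 (fits? ∘ (_∷ L)) (allFin n) (λ _ → ¬fits ∘ fits-tail)) (*-zeroʳ (length L)) ⟩
      0            ≡⟨ *-zeroʳ ∣ A ∣ ⟨
      ∣ A ∣ * 0    ∎

  #inj-upper : ∀ {W : List (Fin m)} → Unique W → n ^ length W * #inj W ≤ ∣ A ∣ ^ length W * n ^ m
  #inj-upper {m} {[]} [] = *-monoʳ-≤ 1 (≤-trans
    (∑-mono {G = λ _ → 1} (maps m n) (λ φ → 𝟙-≤ (fits? []) (λ _ → ≤-refl)))
    (≤-reflexive (∑-maps-1 m n)))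
  #inj-upper {m} {w ∷ W} unique′@(_ ∷ unique) = begin
    n * n ^ length W * #inj (w ∷ W)
      ≡⟨ solve 3 (λ n p i → n :* p :* i := p :* (n :* i)) refl n (n ^ length W) (#inj (w ∷ W)) ⟩
    n ^ length W * (n * #inj (w ∷ W))
      ≤⟨ *-monoʳ-≤ (n ^ length W) (≤-trans (m≤m+n _ _)
           (≤-reflexive (#inj-∷ (Unique.Unique[x∷xs]⇒x∉xs unique′)))) ⟩
    n ^ length W * (∣ A ∣ * #inj W)
      ≡⟨ solve 3 (λ p a i → p :* (a :* i) := a :* (p :* i)) refl (n ^ length W) ∣ A ∣ (#inj W) ⟩
    ∣ A ∣ * (n ^ length W * #inj W)
      ≤⟨ *-monoʳ-≤ ∣ A ∣ (#inj-upper unique) ⟩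
    ∣ A ∣ * (∣ A ∣ ^ length W * n ^ m)
      ≡⟨ *-assoc ∣ A ∣ _ _ ⟨
    ∣ A ∣ * ∣ A ∣ ^ length W * n ^ m ∎
    where
    open ≤-Reasoning
    open +-*-Solver

open Injections

#inj-≡ : ∀ {{_ : NonZero n}} {W : List (Fin m)} → Unique W → ∀ {S T : Subset n} → ∣ S ∣ ≡ ∣ T ∣ →
         #inj S W ≡ #inj T W
#inj-≡ {W = []} [] ∣S∣≡∣T∣ = refl
#inj-≡ {n} {W = w ∷ W} unique′@(_ ∷ unique) {S} {T} ∣S∣≡∣T∣ = *-cancelˡ-≡ _ _ n
  (+-cancelʳ-≡ (length W * #inj S W) _ _ (begin
    n * #inj S (w ∷ W) + length W * #inj S W   ≡⟨ #inj-∷ S w∉W ⟩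
    ∣ S ∣ * #inj S W                           ≡⟨ cong₂ _*_ ∣S∣≡∣T∣ ih ⟩
    ∣ T ∣ * #inj T W                           ≡⟨ #inj-∷ T w∉W ⟨
    n * #inj T (w ∷ W) + length W * #inj T W   ≡⟨ cong (λ i → n * #inj T (w ∷ W) + length W * i) ih ⟨
    n * #inj T (w ∷ W) + length W * #inj S W   ∎))
  where
  open ≡-Reasoning
  w∉W = Unique.Unique[x∷xs]⇒x∉xs unique′
  ih = #inj-≡ unique {S} {T} ∣S∣≡∣T∣

∃-∉ : ∀ (W : List (Fin m)) → length W < m → ∃[ w ] w ∉ˡ W
∃-∉ {m} W ∣W∣<m =
  let (w , 0<) = ∑>0⇒∃ (allFin m) (𝟙 ∘ fresh? Subset.⊤ W) (+-cancelʳ-< (length W) 0 _ (begin-strict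
        length W                          <⟨ ∣W∣<m ⟩
        m                                 ≡⟨ ∣⊤∣≡n m ⟨
        ∣ Subset.⊤ {m} ∣                  ≤⟨ #fresh-lower Subset.⊤ W ⟩
        #fresh Subset.⊤ W + length W      ∎))
  in w , proj₂ (𝟙>0 (fresh? Subset.⊤ W w) 0<)
  where open ≤-Reasoning

module Exceptional {n} {{_ : NonZero n}} (A : Subset n)
  {Bad : U.Pred (Subset n) 0ℓ} (Bad? : U.Decidable Bad) (Bad-mono : ∀ {S T} → S ⊆ T → Bad S → Bad T) where

  BadFits : List (Fin n) → Set
  BadFits L = Fits A L × Bad (setOf L)

  badFits? : U.Decidable BadFits
  badFits? L = fits? A L ×-dec Bad? (setOf L)

  #bad : List (Fin m) → ℕ
  #bad {m} W = ∑ (maps m n) (λ φ → 𝟙 (badFits? (values φ W)))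

  #bad-∷ : ∀ {w : Fin m} {W} → w ∉ˡ W → ∣ A ∣ * #bad W ≤ n * #bad (w ∷ W) + length W * #bad W
  #bad-∷ {m} {w} {W} w∉W = begin
    ∣ A ∣ * #bad W
      ≡⟨ *-distribˡ-∑ ∣ A ∣ (maps m n) _ ⟩
    ∑ (maps m n) (λ φ → ∣ A ∣ * 𝟙 (badFits? (values φ W)))
      ≤⟨ ∑-mono (maps m n) (λ φ → ≤-trans
           (pointwise (values φ W) (badFits? (values φ W)))
           (≤-reflexive (cong
             (λ l → ∑ (allFin n) (λ x → 𝟙 (badFits? (x ∷ values φ W))) + l * 𝟙 (badFits? (values φ W)))
             (length-map (lookup φ) W)))) ⟩
    ∑ (maps m n) (λ φ → ∑ (allFin n) (λ x → 𝟙 (badFits? (x ∷ values φ W))) + length W * 𝟙 (badFits? (values φ W)))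
      ≡⟨ ∑-distrib-+ (maps m n) ⟩
    ∑ (maps m n) (λ φ → ∑ (allFin n) (λ x → 𝟙 (badFits? (x ∷ values φ W)))) +
    ∑ (maps m n) (λ φ → length W * 𝟙 (badFits? (values φ W)))
      ≡⟨ cong₂ _+_ (trans (sym (maps-resample w _))
           (∑-cong (maps m n) λ φ → ∑-cong (allFin n) λ x → cong (𝟙 ∘ badFits?) (values-update φ x w∉W)))
           (*-distribˡ-∑ (length W) (maps m n) _) ⟨
    n * #bad (w ∷ W) + length W * #bad W ∎
    where
    open ≤-Reasoning
    pointwise : ∀ L (d : Dec (BadFits L)) →
      ∣ A ∣ * 𝟙 d ≤ ∑ (allFin n) (λ x → 𝟙 (badFits? (x ∷ L))) + length L * 𝟙 d
    pointwise L (yes (fits , bad)) = begin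
      ∣ A ∣ * 1               ≡⟨ *-identityʳ ∣ A ∣ ⟩
      ∣ A ∣                   ≤⟨ #fresh-lower A L ⟩
      #fresh A L + length L
        ≤⟨ +-mono-≤ (∑-mono (allFin n) λ x → 𝟙-mono (fresh? A L x) (badFits? (x ∷ L)) λ new →
             fits-∷ A fits new , Bad-mono (λ y∈ → ∈-setOf⁺ {L = x ∷ L} (there (∈-setOf⁻ {L = L} y∈))) bad)
             (≤-reflexive (sym (*-identityʳ (length L)))) ⟩
      ∑ (allFin n) (λ x → 𝟙 (badFits? (x ∷ L))) + length L * 1   ∎
    pointwise L (no _) = ≤-trans (≤-reflexive (*-zeroʳ ∣ A ∣)) z≤n

  module _ (k : ℕ) where

    #choose #exceptional : ℕ
    #choose      = length (choose A k)
    #exceptional = length (filter Bad? (choose A k))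

    module _ {W : List (Fin m)} (unique : Unique W) (∣W∣≡k : length W ≡ k) {S : Subset n} (∣S∣≡k : ∣ S ∣ ≡ k) where

      open ≤-Reasoning

      private
        #inj-choose : ∀ {T} → T ∈ˡ choose A k → #inj T W ≡ #inj S W
        #inj-choose T∈ = #inj-≡ unique (trans (proj₂ (∈-choose⁻ A k T∈)) (sym ∣S∣≡k))

      choose-≤-#inj : #choose * #inj S W ≤ #inj A W
      choose-≤-#inj = begin
        #choose * #inj S W
          ≡⟨ ∑-const (choose A k) _ ⟨
        ∑ (choose A k) (λ _ → #inj S W)
          ≤⟨ ∑-mono-∈ (choose A k) (λ T∈ → ≤-reflexive (sym (#inj-choose T∈))) ⟩
        ∑ (choose A k) (λ T → #inj T W)
          ≡⟨ ∑-swap (choose A k) (maps m n) _ ⟩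
        ∑ (maps m n) (λ φ → ∑ (choose A k) (λ T → 𝟙 (fits? T (values φ W))))
          ≤⟨ ∑-mono (maps m n) (λ φ → pointwise (values φ W) (trans (length-map (lookup φ) W) ∣W∣≡k)) ⟩
        #inj A W ∎
        where
        pointwise : ∀ L → length L ≡ k →
          ∑ (choose A k) (λ T → 𝟙 (fits? T L)) ≤ 𝟙 (fits? A L)
        pointwise L ∣L∣≡k with fits? A L
        ... | yes _ = ≤-trans
          (∑-mono-∈ (choose A k) λ {T} T∈ → 𝟙-mono (fits? T L) (within? T)
            λ (unique , L⊆T) → unique , L⊆T , trans ∣L∣≡k (sym (proj₂ (∈-choose⁻ A k T∈))))
          (∑𝟙≤1 within? (choose-unique A k) λ (unique , L⊆T , full) (_ , L⊆T′ , full′) → ⊆-antisym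
            (λ x∈T → All.lookup L⊆T′ (exhausts _ unique L⊆T full x∈T))
            (λ x∈T′ → All.lookup L⊆T (exhausts _ unique L⊆T′ full′ x∈T′)))
          where
          within? : U.Decidable (λ (T : Subset n) → Unique L × All (_∈ T) L × length L ≡ ∣ T ∣)
          within? T = DecUnique.unique? Fin._≟_ L ×-dec All.all? (_∈? T) L ×-dec (length L ≟ ∣ T ∣)
        ... | no ¬fits = ≤-reflexive (∑𝟙≡0 (λ T → fits? T L) (choose A k)
          λ T∈ (unique , L⊆T) → ¬fits (unique , All.map (proj₁ (∈-choose⁻ A k T∈)) L⊆T))

      #bad-≤-exceptional : #bad W ≤ #exceptional * #inj S W
      #bad-≤-exceptional = begin
        #bad W
          ≤⟨ ∑-mono (maps m n) (λ φ → pointwise (values φ W) (trans (length-map (lookup φ) W) ∣W∣≡k)) ⟩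
        ∑ (maps m n) (λ φ → ∑ (filter Bad? (choose A k)) (λ T → 𝟙 (fits? T (values φ W))))
          ≡⟨ ∑-swap (filter Bad? (choose A k)) (maps m n) _ ⟨
        ∑ (filter Bad? (choose A k)) (λ T → #inj T W)
          ≤⟨ ∑-mono-∈ (filter Bad? (choose A k)) (λ T∈ → ≤-reflexive
               (#inj-choose (proj₁ (∈-filter⁻ Bad? {xs = choose A k} T∈)))) ⟩
        ∑ (filter Bad? (choose A k)) (λ _ → #inj S W)
          ≡⟨ ∑-const (filter Bad? (choose A k)) _ ⟩
        #exceptional * #inj S W ∎
        where
        pointwise : ∀ L → length L ≡ k →
          𝟙 (badFits? L) ≤ ∑ (filter Bad? (choose A k)) (λ T → 𝟙 (fits? T L))
        pointwise L ∣L∣≡k = 𝟙-≤ (badFits? L) λ ((unique , L⊆A) , bad) → ≤-trans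
          (≤-reflexive (sym (𝟙-yes (fits? (setOf L) L) (unique , All.tabulate ∈-setOf⁺))))
          (≤∑ (λ T → 𝟙 (fits? T L)) (∈-filter⁺ Bad?
            (∈-choose⁺ A k (All.lookup L⊆A ∘ ∈-setOf⁻) (trans (∣setOf∣ unique) ∣L∣≡k)) bad))

    -- Descends from |W| = k: extending an exceptional injection keeps it exceptional, so the exceptional
    -- fraction of the injections on W does not decrease when W grows.
    #bad-ratio : k ≤ ∣ A ∣ → k ≤ m → ∀ j {W : List (Fin m)} → Unique W → length W + j ≡ k →
                 #choose * #bad W ≤ #exceptional * #inj A W
    #bad-ratio k≤∣A∣ k≤m zero {W} unique ∣W∣≡k
      with (S , _ , ∣S∣≡k) ← ∃-subset-of-size A k k≤∣A∣ = begin
      #choose * #bad W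
        ≤⟨ *-monoʳ-≤ #choose (#bad-≤-exceptional unique ∣W∣≡k′ ∣S∣≡k) ⟩
      #choose * (#exceptional * #inj S W)
        ≡⟨ solve 3 (λ c x i → c :* (x :* i) := x :* (c :* i)) refl #choose #exceptional (#inj S W) ⟩
      #exceptional * (#choose * #inj S W)
        ≤⟨ *-monoʳ-≤ #exceptional (choose-≤-#inj unique ∣W∣≡k′ ∣S∣≡k) ⟩
      #exceptional * #inj A W ∎
      where
      open ≤-Reasoning
      open +-*-Solver
      ∣W∣≡k′ = trans (sym (+-identityʳ _)) ∣W∣≡k
    #bad-ratio {m} k≤∣A∣ k≤m (suc j) {W} unique ∣W∣+1+j≡k =
      let (w , w∉W) = ∃-∉ W (<-≤-trans ∣W∣<k k≤m)
          (e , a≡) = m≤n⇒∃[o]m+o≡n (<-≤-trans ∣W∣<k k≤∣A∣)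
          ih = #bad-ratio k≤∣A∣ k≤m j {w ∷ W} (All.tabulate (λ { i∈W refl → w∉W i∈W }) ∷ unique)
                 (trans (sym (+-suc (length W) j)) ∣W∣+1+j≡k)
      in step (length W) ∣ A ∣ e (trans (+-suc (length W) e) a≡)
           (#bad W) (#bad (w ∷ W)) (#inj A W) (#inj A (w ∷ W)) (#bad-∷ w∉W) (#inj-∷ A w∉W) ih
      where
      ∣W∣<k : length W < k
      ∣W∣<k = subst (length W <_) ∣W∣+1+j≡k (m<m+n (length W) z<s)
      step : ∀ d a e → d + suc e ≡ a → ∀ q q′ i i′ → a * q ≤ n * q′ + d * q → n * i′ + d * i ≡ a * i →
             #choose * q′ ≤ #exceptional * i′ → #choose * q ≤ #exceptional * i
      step d _ e refl q q′ i i′ qq ii ih = *-cancelˡ-≤ (suc e) (begin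
        suc e * (#choose * q)        ≡⟨ solve 3 (λ e c q → e :* (c :* q) := c :* (e :* q)) refl (suc e) #choose q ⟩
        #choose * (suc e * q)
          ≤⟨ *-monoʳ-≤ #choose (+-cancelʳ-≤ (d * q) _ _ (≤-trans (≤-reflexive
               (solve 3 (λ d e q → e :* q :+ d :* q := (d :+ e) :* q) refl d (suc e) q)) qq)) ⟩
        #choose * (n * q′)           ≡⟨ solve 3 (λ n c q → c :* (n :* q) := n :* (c :* q)) refl n #choose q′ ⟩
        n * (#choose * q′)           ≤⟨ *-monoʳ-≤ n ih ⟩
        n * (#exceptional * i′)      ≡⟨ solve 3 (λ n c q → c :* (n :* q) := n :* (c :* q)) refl #exceptional n i′ ⟩
        #exceptional * (n * i′)
          ≡⟨ cong (#exceptional *_) (+-cancelʳ-≡ (d * i) _ _ (trans ii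
               (solve 3 (λ d e q → (d :+ e) :* q := e :* q :+ d :* q) refl d (suc e) i))) ⟩
        #exceptional * (suc e * i)   ≡⟨ solve 3 (λ e c q → c :* (e :* q) := e :* (c :* q)) refl (suc e) #exceptional i ⟩
        suc e * (#exceptional * i)   ∎)
        where
        open ≤-Reasoning
        open +-*-Solver

    #choose>0 : k ≤ ∣ A ∣ → 0 < #choose
    #choose>0 k≤∣A∣ = let (S , S⊆A , ∣S∣≡k) = ∃-subset-of-size A k k≤∣A∣ in
      ∈-length (∈-choose⁺ A k S⊆A ∣S∣≡k)

-- The counting induction

image-cong-⊆ : ∀ {φ ψ : Fin m → Fin n} {S} → (∀ {i} → i ∈ S → φ i ≡ ψ i) → image φ S ⊆ image ψ S
image-cong-⊆ {φ = φ} {ψ} {S} φ≗ψ x∈ =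
  let (i , i∈S , φi≡x) = ∈-comprehension⁻ (λ w → any? (λ v → (v ∈? S) ×-dec (φ v Fin.≟ w))) x∈
  in ∈-comprehension⁺ (λ w → any? (λ v → (v ∈? S) ×-dec (ψ v Fin.≟ w)))
       (i , i∈S , trans (sym (φ≗ψ i∈S)) φi≡x)

image⊆setOf : ∀ {φ : Vec (Fin n) m} {S W} → (∀ {i} → i ∈ S → i ∈ˡ W) →
              image (lookup φ) S ⊆ setOf (values φ W)
image⊆setOf {φ = φ} {S} {W} S⊆W x∈ =
  let (i , i∈S , φi≡x) = ∈-comprehension⁻ (λ w → any? (λ v → (v ∈? S) ×-dec (lookup φ v Fin.≟ w))) x∈
  in ∈-setOf⁺ {L = values φ W} (subst (_∈ˡ values φ W) φi≡x (∈-map⁺ (lookup φ) (S⊆W i∈S)))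

filter-++-↭ : ∀ {A : Set} {P : U.Pred A 0ℓ} (P? : U.Decidable P) xs →
              filter P? xs ++ filter (¬? ∘ P?) xs ↭ xs
filter-++-↭ P? [] = ↭-refl
filter-++-↭ P? (x ∷ xs) with P? x
... | yes _ = prep x (filter-++-↭ P? xs)
... | no _  = ↭-trans (↭.shift x (filter P? xs) (filter (¬? ∘ P?) xs)) (prep x (filter-++-↭ P? xs))

Unique-resp-↭ : ∀ {A : Set} {xs ys : List A} → xs ↭ ys → Unique xs → Unique ys
Unique-resp-↭ {A} = ↭ₛ.Unique-resp-↭ (setoid A) ∘ ↭⇒↭ₛ

bad-count-arith : ∀ n a b m e j K X C MR Q M I y .{{_ : NonZero n}} .{{_ : NonZero b}} .{{_ : NonZero C}} →
  b ≤ a → n ^ m * y ≤ MR * Q → C * Q ≤ X * I → n ^ suc e * I ≤ a ^ suc e * n ^ m →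
  (3 * b) ^ e * MR ≤ (4 * n) ^ e * M → X * (K * (4 * a) ^ (suc e + j)) ≤ (3 * b) ^ (suc e + j) * C →
  4 * n * K * y ≤ 3 * b * M
bad-count-arith n a b m e j K X C MR Q M I y b≤a y≤ Q≤ I≤ MR≤ X≤ =
  *-cancelˡ-≤ (N * C * t ^ e * f ^ e) {{nz}} (begin
    N * C * t ^ e * f ^ e * (4 * n * K * y)
      ≡⟨ cong (λ z → N * C * t ^ e * z * (4 * n * K * y)) (^-* 4 n e) ⟩
    N * C * t ^ e * (4 ^ e * n ^ e) * (4 * n * K * y)
      ≡⟨ solve 8 (λ N C te fe ne n K y → N :* C :* te :* (fe :* ne) :* (con 4 :* n :* K :* y)
           := (N :* y) :* (C :* te :* (n :* ne) :* (con 4 :* fe) :* K)) refl N C (t ^ e) (4 ^ e) (n ^ e) n K y ⟩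
    (N * y) * (C * t ^ e * n ^ suc e * 4 ^ suc e * K)
      ≤⟨ *-monoˡ-≤ _ y≤ ⟩
    (MR * Q) * (C * t ^ e * n ^ suc e * 4 ^ suc e * K)
      ≡⟨ solve 7 (λ MR Q C te nd fd K → (MR :* Q) :* (C :* te :* nd :* fd :* K)
           := (te :* MR) :* ((C :* Q) :* (nd :* fd :* K))) refl MR Q C (t ^ e) (n ^ suc e) (4 ^ suc e) K ⟩
    (t ^ e * MR) * ((C * Q) * (n ^ suc e * 4 ^ suc e * K))
      ≤⟨ *-mono-≤ MR≤ (*-monoˡ-≤ _ Q≤) ⟩
    (f ^ e * M) * ((X * I) * (n ^ suc e * 4 ^ suc e * K))
      ≡⟨ solve 6 (λ fM X I nd fd K → fM :* ((X :* I) :* (nd :* fd :* K)) := (nd :* I) :* (fM :* X :* fd :* K))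
           refl (f ^ e * M) X I (n ^ suc e) (4 ^ suc e) K ⟩
    (n ^ suc e * I) * (f ^ e * M * X * 4 ^ suc e * K)
      ≤⟨ *-monoˡ-≤ _ I≤ ⟩
    (a ^ suc e * N) * (f ^ e * M * X * 4 ^ suc e * K)
      ≡⟨ solve 6 (λ ad N fM X fd K → (ad :* N) :* (fM :* X :* fd :* K) := (N :* fM) :* (X :* (K :* (fd :* ad))))
           refl (a ^ suc e) N (f ^ e * M) X (4 ^ suc e) K ⟩
    (N * (f ^ e * M)) * (X * (K * (4 ^ suc e * a ^ suc e)))
      ≡⟨ cong (λ z → (N * (f ^ e * M)) * (X * (K * z))) (^-* 4 a (suc e)) ⟨
    (N * (f ^ e * M)) * (X * (K * g ^ suc e))
      ≤⟨ *-monoʳ-≤ (N * (f ^ e * M)) X≤′ ⟩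
    (N * (f ^ e * M)) * (t ^ suc e * C)
      ≡⟨ solve 6 (λ N fe M t te C → (N :* (fe :* M)) :* ((t :* te) :* C) := N :* C :* te :* fe :* (t :* M))
           refl N (f ^ e) M t (t ^ e) C ⟩
    N * C * t ^ e * f ^ e * (t * M) ∎)
  where
  open ≤-Reasoning
  open +-*-Solver
  N = n ^ m
  t = 3 * b
  f = 4 * n
  g = 4 * a
  instance
    t≢0 : NonZero t
    t≢0 = m*n≢0 3 b
    f≢0 : NonZero f
    f≢0 = m*n≢0 4 n
  nz : NonZero (N * C * t ^ e * f ^ e)
  nz = m*n≢0 _ _ {{m*n≢0 _ _ {{m*n≢0 _ _ {{m^n≢0 n m}}}} {{m^n≢0 t e}}}} {{m^n≢0 f e}}
  ^-* : ∀ x y k → (x * y) ^ k ≡ x ^ k * y ^ k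
  ^-* x y zero    = refl
  ^-* x y (suc k) rewrite ^-* x y k =
    solve 4 (λ x y p q → x :* y :* (p :* q) := x :* p :* (y :* q)) refl x y (x ^ k) (y ^ k)
  X≤′ : X * (K * g ^ suc e) ≤ t ^ suc e * C
  X≤′ = *-cancelʳ-≤ _ _ (t ^ j) {{m^n≢0 t j}} (begin
    X * (K * g ^ suc e) * t ^ j
      ≤⟨ *-monoʳ-≤ (X * (K * g ^ suc e)) (^-monoˡ-≤ j (*-mono-≤ {3} {4} (n≤1+n 3) b≤a)) ⟩
    X * (K * g ^ suc e) * g ^ j
      ≡⟨ trans (solve 4 (λ X K g h → X :* (K :* g) :* h := X :* (K :* (g :* h))) refl X K (g ^ suc e) (g ^ j))
           (cong (λ z → X * (K * z)) (sym (^-distribˡ-+-* g (suc e) j))) ⟩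
    X * (K * g ^ (suc e + j))
      ≤⟨ X≤ ⟩
    t ^ (suc e + j) * C
      ≡⟨ trans (cong (_* C) (^-distribˡ-+-* t (suc e) j))
           (solve 3 (λ p q c → p :* q :* c := p :* c :* q) refl (t ^ suc e) (t ^ j) C) ⟩
    t ^ suc e * C * t ^ j ∎)

extension-arith : ∀ n b s D K M M′ G H .{{_ : NonZero D}} → 32 * s ≤ b → 4 * D ≤ K →
  b * M ≤ n * G + s * M → G ≤ M′ + H → 4 * n * K * H ≤ D * (3 * b * M) →
  3 * b * M ≤ 4 * n * M′
extension-arith n b s D K M M′ G H 32s≤b 4D≤K bM≤ G≤ H≤ =
  *-cancelˡ-≤ 8 (+-cancelʳ-≤ (b * M + 7 * (b * M)) _ _ (begin
    8 * (3 * b * M) + (b * M + 7 * (b * M))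
      ≡⟨ solve 2 (λ b M → con 8 :* (con 3 :* b :* M) :+ (b :* M :+ con 7 :* (b :* M)) := con 32 :* (b :* M)) refl b M ⟩
    32 * (b * M)
      ≤⟨ *-monoʳ-≤ 32 (≤-trans bM≤ (+-monoˡ-≤ (s * M) (*-monoʳ-≤ n G≤))) ⟩
    32 * (n * (M′ + H) + s * M)
      ≡⟨ solve 5 (λ n M′ H s M → con 32 :* (n :* (M′ :+ H) :+ s :* M)
           := con 8 :* (con 4 :* n :* M′) :+ (con 32 :* s :* M :+ con 2 :* (con 16 :* n :* H))) refl n M′ H s M ⟩
    8 * (4 * n * M′) + (32 * s * M + 2 * (16 * n * H))
      ≤⟨ +-monoʳ-≤ (8 * (4 * n * M′)) (+-mono-≤ (*-monoˡ-≤ M 32s≤b)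
           (≤-trans (*-monoʳ-≤ 2 16nH≤) (≤-trans (≤-reflexive
             (solve 2 (λ b M → con 2 :* (con 3 :* b :* M) := con 6 :* (b :* M)) refl b M)) (*-monoˡ-≤ (b * M) (n≤1+n 6))))) ⟩
    8 * (4 * n * M′) + (b * M + 7 * (b * M)) ∎))
  where
  open ≤-Reasoning
  open +-*-Solver
  16nH≤ : 16 * n * H ≤ 3 * b * M
  16nH≤ = *-cancelˡ-≤ D (begin
    D * (16 * n * H)      ≡⟨ solve 3 (λ D n H → D :* (con 16 :* n :* H) := con 4 :* n :* (con 4 :* D) :* H) refl D n H ⟩
    4 * n * (4 * D) * H   ≤⟨ *-monoˡ-≤ H (*-monoʳ-≤ (4 * n) 4D≤K) ⟩
    4 * n * K * H         ≤⟨ H≤ ⟩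
    D * (3 * b * M)       ∎)

module Embedding {m k n} {{_ : NonZero n}} (A : Subset n)
  {Bad : U.Pred (Subset n) 0ℓ} (Bad? : U.Decidable Bad) (Bad-mono : ∀ {S T} → S ⊆ T → Bad S → Bad T)
  (f : Fin m → Subset n) (f⊆A : ∀ v → f v ⊆ A) (N : Fin k → Subset m)
  where

  open Exceptional A Bad? Bad-mono

  Valid : List (Fin m) → Vec (Fin n) m → Set
  Valid S φ = All (λ i → lookup φ i ∈ f i) S × Unique (values φ S) ×
              (∀ u → (∀ i → i ∈ N u → i ∈ˡ S) → ¬ Bad (image (lookup φ) (N u)))

  covered? : ∀ S u → Dec (∀ i → i ∈ N u → i ∈ˡ S)
  covered? S u = all? λ i → (i ∈? N u) →-dec (i ∈ˡ? S)

  valid? : ∀ S → U.Decidable (Valid S)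
  valid? S φ = All.all? (λ i → lookup φ i ∈? f i) S ×-dec DecUnique.unique? Fin._≟_ (values φ S) ×-dec
    all? (λ u → covered? S u →-dec ¬? (Bad? (image (lookup φ) (N u))))

  #valid : List (Fin m) → ℕ
  #valid S = ∑ (maps m n) (𝟙 ∘ valid? S)

  valid-↭ : ∀ {S T} → S ↭ T → ∀ φ → Valid S φ → Valid T φ
  valid-↭ S↭T φ (∈f , unique , good) = ↭.All-resp-↭ S↭T ∈f , Unique-resp-↭ (↭.map⁺ (lookup φ) S↭T) unique ,
    λ u N⊆T → good u λ i i∈N → ↭.∈-resp-↭ (↭-sym S↭T) (N⊆T i i∈N)

  #valid-↭ : ∀ {S T} → S ↭ T → #valid S ≡ #valid T
  #valid-↭ {S} {T} S↭T = ∑-cong (maps m n) λ φ →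
    𝟙-cong (valid? S φ) (valid? T φ) (valid-↭ S↭T φ) (valid-↭ (↭-sym S↭T) φ)

  valid-cong : ∀ {S} φ ψ → (∀ {i} → i ∈ˡ S → lookup φ i ≡ lookup ψ i) → Valid S φ → Valid S ψ
  valid-cong {S} φ ψ φ≗ψ (∈f , unique , good) =
    All.tabulate (λ i∈S → subst (_∈ f _) (φ≗ψ i∈S) (All.lookup ∈f i∈S)) ,
    subst Unique (values-cong {φ = φ} {ψ} φ≗ψ) unique ,
    λ u N⊆S → good u N⊆S ∘ Bad-mono (image-cong-⊆ (λ i∈N → sym (φ≗ψ (N⊆S _ i∈N))))

  valid-dependsOn : ∀ S → DependsOn (_∈ˡ S) (𝟙 ∘ valid? S)
  valid-dependsOn S φ ψ φ≗ψ = 𝟙-cong (valid? S φ) (valid? S ψ)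
    (valid-cong φ ψ φ≗ψ) (valid-cong ψ φ (λ i∈S → sym (φ≗ψ i∈S)))

  valid-filter : ∀ {P : U.Pred (Fin m) 0ℓ} (P? : U.Decidable P) {S} φ → Valid S φ → Valid (filter P? S) φ
  valid-filter P? {S} φ (∈f , unique , good) =
    All.filter⁺ P? ∈f , AllPairs.map⁺ (AllPairs.filter⁺ P? (AllPairs.map⁻ unique)) ,
    λ u N⊆ → good u λ i i∈N → proj₁ (∈-filter⁻ P? {xs = S} (N⊆ i i∈N))

  Extends : List (Fin m) → Fin m → Vec (Fin n) m → Set
  Extends S v φ = Valid S φ × lookup φ v ∈ f v × lookup φ v ∉ˡ values φ S

  extends? : ∀ S v → U.Decidable (Extends S v)
  extends? S v φ = valid? S φ ×-dec (lookup φ v ∈? f v) ×-dec ¬? (lookup φ v ∈ˡ? values φ S)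

  Violates : List (Fin m) → Fin m → Fin k → Vec (Fin n) m → Set
  Violates S v u φ = v ∈ N u × (∀ i → i ∈ N u → i ∈ˡ v ∷ S) × Extends S v φ × Bad (image (lookup φ) (N u))

  violates? : ∀ S v u → U.Decidable (Violates S v u)
  violates? S v u φ = (v ∈? N u) ×-dec covered? (v ∷ S) u ×-dec extends? S v φ ×-dec Bad? (image (lookup φ) (N u))

  #extends : List (Fin m) → Fin m → ℕ
  #extends S v = ∑ (maps m n) (𝟙 ∘ extends? S v)

  #violates : List (Fin m) → Fin m → Fin k → ℕ
  #violates S v u = ∑ (maps m n) (𝟙 ∘ violates? S v u)

  #extends-lower : ∀ {S v b} → v ∉ˡ S → b ≤ ∣ f v ∣ →
                   b * #valid S ≤ n * #extends S v + length S * #valid S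
  #extends-lower {S} {v} {b} v∉S b≤ = begin
    b * #valid S
      ≡⟨ *-distribˡ-∑ b (maps m n) _ ⟩
    ∑ (maps m n) (λ φ → b * 𝟙 (valid? S φ))
      ≤⟨ ∑-mono (maps m n) (λ φ → pointwise φ (valid? S φ)) ⟩
    ∑ (maps m n) (λ φ → ∑ (allFin n) (λ x → 𝟙 (extends? S v (φ [ v ]≔ x))) + length S * 𝟙 (valid? S φ))
      ≡⟨ ∑-distrib-+ (maps m n) ⟩
    ∑ (maps m n) (λ φ → ∑ (allFin n) (λ x → 𝟙 (extends? S v (φ [ v ]≔ x)))) +
    ∑ (maps m n) (λ φ → length S * 𝟙 (valid? S φ))
      ≡⟨ cong₂ _+_ (sym (maps-resample v (𝟙 ∘ extends? S v))) (*-distribˡ-∑ (length S) (maps m n) _) ⟨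
    n * #extends S v + length S * #valid S ∎
    where
    open ≤-Reasoning
    pointwise : ∀ φ (d : Dec (Valid S φ)) →
      b * 𝟙 d ≤ ∑ (allFin n) (λ x → 𝟙 (extends? S v (φ [ v ]≔ x))) + length S * 𝟙 d
    pointwise φ (yes valid) = begin
      b * 1     ≡⟨ *-identityʳ b ⟩
      b         ≤⟨ b≤ ⟩
      ∣ f v ∣   ≤⟨ #fresh-lower (f v) (values φ S) ⟩
      #fresh (f v) (values φ S) + length (values φ S)
        ≤⟨ +-mono-≤
             (∑-mono (allFin n) λ x → 𝟙-mono (fresh? (f v) (values φ S) x) (extends? S v (φ [ v ]≔ x))
               λ (x∈f , x∉) → let φ≗ = lookup-update-∉ φ x v∉S in
                 valid-cong φ (φ [ v ]≔ x) (λ i∈S → sym (φ≗ i∈S)) valid ,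
                 subst (_∈ f v) (sym (Vec.lookup∘update v φ x)) x∈f ,
                 subst₂ _∉ˡ_ (sym (Vec.lookup∘update v φ x))
                   (values-cong {φ = φ} {φ [ v ]≔ x} (λ i∈S → sym (φ≗ i∈S))) x∉)
             (≤-reflexive (trans (length-map (lookup φ) S) (sym (*-identityʳ (length S))))) ⟩
      ∑ (allFin n) (λ x → 𝟙 (extends? S v (φ [ v ]≔ x))) + length S * 1 ∎
    pointwise φ (no _) = ≤-trans (≤-reflexive (*-zeroʳ b)) z≤n

  extends⇒valid⊎violates : ∀ S v φ → Extends S v φ → Valid (v ∷ S) φ ⊎ (∃[ u ] Violates S v u φ)
  extends⇒valid⊎violates S v φ ext@((∈f , unique , good) , v∈f , v∉) with any? (λ u → violates? S v u φ)
  ... | yes violated = inj₂ violated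
  ... | no ¬violated = inj₁ (v∈f ∷ ∈f , All.tabulate (λ { i∈ refl → v∉ i∈ }) ∷ unique , good′)
    where
    good′ : ∀ u → (∀ i → i ∈ N u → i ∈ˡ v ∷ S) → ¬ Bad (image (lookup φ) (N u))
    good′ u N⊆ bad with v ∈? N u
    ... | yes v∈N = ¬violated (u , v∈N , N⊆ , ext , bad)
    ... | no v∉N  = good u (λ i i∈N → case N⊆ i i∈N of
      λ { (here refl) → contradiction i∈N v∉N ; (there i∈S) → i∈S }) bad

  #extends-upper : ∀ S v → #extends S v ≤ #valid (v ∷ S) + ∑ (allFin k) (#violates S v)
  #extends-upper S v = begin
    #extends S v
      ≤⟨ ∑-mono (maps m n) (λ φ → 𝟙-≤ (extends? S v φ) (pointwise φ ∘ extends⇒valid⊎violates S v φ)) ⟩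
    ∑ (maps m n) (λ φ → 𝟙 (valid? (v ∷ S) φ) + ∑ (allFin k) (λ u → 𝟙 (violates? S v u φ)))
      ≡⟨ ∑-distrib-+ (maps m n) ⟩
    #valid (v ∷ S) + ∑ (maps m n) (λ φ → ∑ (allFin k) (λ u → 𝟙 (violates? S v u φ)))
      ≡⟨ cong (#valid (v ∷ S) +_) (∑-swap (maps m n) (allFin k) (λ φ u → 𝟙 (violates? S v u φ))) ⟩
    #valid (v ∷ S) + ∑ (allFin k) (#violates S v) ∎
    where
    open ≤-Reasoning
    pointwise : ∀ φ → Valid (v ∷ S) φ ⊎ (∃[ u ] Violates S v u φ) →
      1 ≤ 𝟙 (valid? (v ∷ S) φ) + ∑ (allFin k) (λ u → 𝟙 (violates? S v u φ))
    pointwise φ (inj₁ valid) =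
      ≤-trans (≤-reflexive (sym (𝟙-yes (valid? (v ∷ S) φ) valid))) (m≤m+n _ _)
    pointwise φ (inj₂ (u , violates)) = ≤-trans
      (≤-trans (≤-reflexive (sym (𝟙-yes (violates? S v u φ) violates)))
        (≤∑ (λ u → 𝟙 (violates? S v u φ)) (∈-allFin u)))
      (m≤n+m _ _)

  module _ (S : List (Fin m)) (u : Fin k) where

    inner outer : List (Fin m)
    inner = filter (_∈? N u) S
    outer = filter (¬? ∘ (_∈? N u)) S

    #violates-independent : ∀ {v} → v ∉ˡ S → n ^ m * #violates S v u ≤ #valid outer * #bad (v ∷ inner)
    #violates-independent {v} v∉S = begin
      n ^ m * #violates S v u
        ≤⟨ *-monoʳ-≤ (n ^ m) (∑-mono (maps m n) λ φ → ≤-trans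
             (𝟙-mono (violates? S v u φ) (valid? outer φ ×-dec badFits? (values φ (v ∷ inner))) (split φ))
             (≤-reflexive (𝟙-× (valid? outer φ) (badFits? (values φ (v ∷ inner)))))) ⟩
      n ^ m * ∑ (maps m n) (λ φ → 𝟙 (valid? outer φ) * 𝟙 (badFits? (values φ (v ∷ inner))))
        ≡⟨ maps-independent (_∈ˡ? outer) disjoint (valid-dependsOn outer)
             (λ φ ψ φ≗ψ → cong (𝟙 ∘ badFits?) (values-cong {φ = φ} {ψ} {v ∷ inner} φ≗ψ)) ⟨
      #valid outer * #bad (v ∷ inner) ∎
      where
      open ≤-Reasoning
      split : ∀ φ → Violates S v u φ → Valid outer φ × BadFits (values φ (v ∷ inner))
      split φ (v∈N , N⊆ , (valid , v∈f , v∉) , bad) =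
        let (∈f , unique , _) = valid-filter (_∈? N u) φ valid in
        valid-filter (¬? ∘ (_∈? N u)) φ valid ,
        (All.tabulate (λ { φi∈ refl → case ∈-map⁻ (lookup φ) φi∈ of λ (i , i∈ , φv≡φi) →
            v∉ (subst (_∈ˡ values φ S) (sym φv≡φi)
              (∈-map⁺ (lookup φ) (proj₁ (∈-filter⁻ (_∈? N u) {xs = S} i∈)))) }) ∷ unique ,
          f⊆A v v∈f ∷ All.map⁺ (All.map (λ {i} → f⊆A i) ∈f)) ,
        Bad-mono (image⊆setOf {φ = φ} {W = v ∷ inner} λ {i} i∈N → case N⊆ i i∈N of
          λ { (here i≡v) → here i≡v ; (there i∈S) → there (∈-filter⁺ (_∈? N u) i∈S i∈N) }) bad
      disjoint : ∀ {i} → i ∈ˡ outer → i ∉ˡ v ∷ inner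
      disjoint i∈ (here refl) = v∉S (proj₁ (∈-filter⁻ (¬? ∘ (_∈? N u)) {xs = S} i∈))
      disjoint i∈ (there i∈′) = proj₂ (∈-filter⁻ (¬? ∘ (_∈? N u)) {xs = S} i∈) (proj₂ (∈-filter⁻ (_∈? N u) {xs = S} i∈′))

  module _ (b D K Δ : ℕ) {{_ : NonZero D}} {{_ : NonZero b}} (b≤ : ∀ v → b ≤ ∣ f v ∣) (b≤a : b ≤ ∣ A ∣)
    (32m≤b : 32 * m ≤ b) (4D≤K : 4 * D ≤ K) (Δ≤m : Δ ≤ m)
    (indeg : ∀ u → ∣ N u ∣ ≤ Δ) (outdeg : ∀ v → ∑ (allFin k) (λ u → 𝟙 (v ∈? N u)) ≤ D)
    (few-exceptional : #exceptional Δ * (K * (4 * ∣ A ∣) ^ Δ) ≤ (3 * b) ^ Δ * #choose Δ)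
    where

    private
      Δ≤a : Δ ≤ ∣ A ∣
      Δ≤a = ≤-trans Δ≤m (≤-trans (m≤n*m m 32) (≤-trans 32m≤b b≤a))

      instance
        #choose≢0 : NonZero (#choose Δ)
        #choose≢0 = >-nonZero (#choose>0 Δ Δ≤a)

    GrowsBelow : ℕ → Set
    GrowsBelow ℓ = ∀ S v → length S < ℓ → Unique (v ∷ S) → 3 * b * #valid S ≤ 4 * n * #valid (v ∷ S)

    grows-++ : ∀ {ℓ} → GrowsBelow ℓ → ∀ U R → length (U ++ R) ≤ ℓ → Unique (U ++ R) →
               (3 * b) ^ length U * #valid R ≤ (4 * n) ^ length U * #valid (U ++ R)
    grows-++ grows [] R _ _ = ≤-refl
    grows-++ grows (w ∷ U) R ∣wU++R∣≤ℓ unique′@(_ ∷ unique) = begin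
      3 * b * (3 * b) ^ length U * #valid R
        ≡⟨ *-assoc (3 * b) _ _ ⟩
      3 * b * ((3 * b) ^ length U * #valid R)
        ≤⟨ *-monoʳ-≤ (3 * b) (grows-++ grows U R (<⇒≤ ∣wU++R∣≤ℓ) unique) ⟩
      3 * b * ((4 * n) ^ length U * #valid (U ++ R))
        ≡⟨ solve 3 (λ b p x → con 3 :* b :* (p :* x) := p :* (con 3 :* b :* x)) refl b ((4 * n) ^ length U) _ ⟩
      (4 * n) ^ length U * (3 * b * #valid (U ++ R))
        ≤⟨ *-monoʳ-≤ ((4 * n) ^ length U) (grows (U ++ R) w ∣wU++R∣≤ℓ unique′) ⟩
      (4 * n) ^ length U * (4 * n * #valid (w ∷ U ++ R))
        ≡⟨ solve 3 (λ n p x → p :* (con 4 :* n :* x) := con 4 :* n :* p :* x) refl n ((4 * n) ^ length U) _ ⟩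
      4 * n * (4 * n) ^ length U * #valid (w ∷ U ++ R) ∎
      where
      open ≤-Reasoning
      open +-*-Solver

    #violates-upper : ∀ {ℓ} → GrowsBelow ℓ → ∀ S v → length S ≤ ℓ → Unique (v ∷ S) → ∀ u → v ∈ N u →
                      4 * n * K * #violates S v u ≤ 3 * b * #valid S
    #violates-upper grows S v ∣S∣≤ℓ unique′@(_ ∷ unique) u v∈N =
      let (j , d+j≡Δ) = m≤n⇒∃[o]m+o≡n d≤Δ in
      bad-count-arith n ∣ A ∣ b m (length (inner S u)) j K (#exceptional Δ) (#choose Δ)
        (#valid (outer S u)) (#bad (v ∷ inner S u)) (#valid S) (#inj A (v ∷ inner S u)) (#violates S v u)
        b≤a (#violates-independent S u v∉S)
        (#bad-ratio Δ Δ≤a Δ≤m j unique-v∷inner d+j≡Δ)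
        (#inj-upper A unique-v∷inner)
        (≤-trans (grows-++ grows (inner S u) (outer S u)
            (≤-trans (≤-reflexive (↭.↭-length S↭)) ∣S∣≤ℓ) (Unique-resp-↭ (↭-sym S↭) unique))
          (≤-reflexive (cong ((4 * n) ^ length (inner S u) *_) (#valid-↭ S↭))))
        (subst (λ Δ′ → #exceptional Δ * (K * (4 * ∣ A ∣) ^ Δ′) ≤ (3 * b) ^ Δ′ * #choose Δ)
          (sym d+j≡Δ) few-exceptional)
      where
      v∉S = Unique.Unique[x∷xs]⇒x∉xs unique′
      S↭ = filter-++-↭ (_∈? N u) S
      unique-v∷inner : Unique (v ∷ inner S u)
      unique-v∷inner = All.tabulate (λ { i∈ refl → v∉S (proj₁ (∈-filter⁻ (_∈? N u) {xs = S} i∈)) }) ∷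
                       Unique.filter⁺ (_∈? N u) unique
      d≤Δ : length (v ∷ inner S u) ≤ Δ
      d≤Δ = ≤-trans (length≤ (N u) unique-v∷inner (v∈N ∷ All.all-filter (_∈? N u) S)) (indeg u)

    ∑-violates-upper : ∀ {ℓ} → GrowsBelow ℓ → ∀ S v → length S ≤ ℓ → Unique (v ∷ S) →
                       4 * n * K * ∑ (allFin k) (#violates S v) ≤ D * (3 * b * #valid S)
    ∑-violates-upper grows S v ∣S∣≤ℓ unique = begin
      4 * n * K * ∑ (allFin k) (#violates S v)
        ≡⟨ *-distribˡ-∑ (4 * n * K) (allFin k) _ ⟩
      ∑ (allFin k) (λ u → 4 * n * K * #violates S v u)
        ≤⟨ ∑-mono (allFin k) (λ u → pointwise u (v ∈? N u)) ⟩
      ∑ (allFin k) (λ u → 3 * b * #valid S * 𝟙 (v ∈? N u))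
        ≡⟨ *-distribˡ-∑ (3 * b * #valid S) (allFin k) _ ⟨
      3 * b * #valid S * ∑ (allFin k) (λ u → 𝟙 (v ∈? N u))
        ≤⟨ *-monoʳ-≤ (3 * b * #valid S) (outdeg v) ⟩
      3 * b * #valid S * D
        ≡⟨ *-comm _ D ⟩
      D * (3 * b * #valid S) ∎
      where
      open ≤-Reasoning
      pointwise : ∀ u (d : Dec (v ∈ N u)) → 4 * n * K * #violates S v u ≤ 3 * b * #valid S * 𝟙 d
      pointwise u (yes v∈N) = ≤-trans (#violates-upper grows S v ∣S∣≤ℓ unique u v∈N)
        (≤-reflexive (sym (*-identityʳ _)))
      pointwise u (no v∉N) = ≤-trans (≤-reflexive (trans
        (cong (4 * n * K *_) (∑𝟙≡0 (violates? S v u) (maps m n) (λ _ → v∉N ∘ proj₁)))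
        (*-zeroʳ (4 * n * K)))) z≤n

    grows : ∀ ℓ → GrowsBelow ℓ
    grows (suc ℓ) S v (s≤s ∣S∣≤ℓ) unique′@(_ ∷ unique) =
      extension-arith n b (length S) D K (#valid S) (#valid (v ∷ S)) (#extends S v) (∑ (allFin k) (#violates S v))
        (≤-trans (*-monoʳ-≤ 32 ∣S∣≤m) 32m≤b) 4D≤K
        (#extends-lower (Unique.Unique[x∷xs]⇒x∉xs unique′) (b≤ v)) (#extends-upper S v)
        (∑-violates-upper (grows ℓ) S v ∣S∣≤ℓ unique′)
      where
      ∣S∣≤m : length S ≤ m
      ∣S∣≤m = ≤-trans (length≤ Subset.⊤ unique (All.tabulate (λ _ → ∈⊤))) (∣p∣≤n Subset.⊤)

    ¬Bad-⊥ : ¬ Bad Subset.⊥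
    ¬Bad-⊥ bad = <⇒≱ 3b^Δ<K4a^Δ (*-cancelʳ-≤ _ _ (#choose Δ) (begin
      K * (4 * ∣ A ∣) ^ Δ * #choose Δ          ≡⟨ *-comm _ (#choose Δ) ⟩
      #choose Δ * (K * (4 * ∣ A ∣) ^ Δ)
        ≡⟨ cong (λ S → length S * (K * (4 * ∣ A ∣) ^ Δ)) (filter-all Bad? all-bad) ⟨
      #exceptional Δ * (K * (4 * ∣ A ∣) ^ Δ)   ≤⟨ few-exceptional ⟩
      (3 * b) ^ Δ * #choose Δ                  ∎))
      where
      open ≤-Reasoning
      all-bad : All Bad (choose A Δ)
      all-bad = All.tabulate λ _ → Bad-mono (λ x∈⊥ → contradiction x∈⊥ ∉⊥) bad
      instance
        a≢0 : NonZero ∣ A ∣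
        a≢0 = >-nonZero (<-≤-trans (>-nonZero⁻¹ b) b≤a)
        4a≢0 : NonZero (4 * ∣ A ∣)
        4a≢0 = m*n≢0 4 ∣ A ∣
      3b^Δ<K4a^Δ : (3 * b) ^ Δ < K * (4 * ∣ A ∣) ^ Δ
      3b^Δ<K4a^Δ = begin-strict
        (3 * b) ^ Δ                ≤⟨ ^-monoˡ-≤ Δ (*-mono-≤ {3} {4} (n≤1+n 3) b≤a) ⟩
        (4 * ∣ A ∣) ^ Δ            <⟨ m<m*n _ K {{m^n≢0 (4 * ∣ A ∣) Δ}} (≤-trans (s≤s (s≤s z≤n)) (≤-trans (m≤m*n 4 D) 4D≤K)) ⟩
        (4 * ∣ A ∣) ^ Δ * K        ≡⟨ *-comm _ K ⟩
        K * (4 * ∣ A ∣) ^ Δ        ∎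

    #valid>0 : ∀ {S} → Unique S → 0 < #valid S
    #valid>0 [] = begin-strict
      0         <⟨ m^n>0 n m ⟩
      n ^ m     ≡⟨ ∑-maps-1 m n ⟨
      ∑ (maps m n) (λ _ → 1)
        ≤⟨ ∑-mono (maps m n) (λ φ → ≤-reflexive (sym (𝟙-yes (valid? [] φ) ([] , [] , λ u N⊆[] bad →
             ¬Bad-⊥ (Bad-mono (image-of-empty φ u N⊆[]) bad))))) ⟩
      #valid [] ∎
      where
      open ≤-Reasoning
      image-of-empty : ∀ φ u → (∀ i → i ∈ N u → i ∈ˡ []) → image (lookup φ) (N u) ⊆ Subset.⊥
      image-of-empty φ u N⊆[] x∈ with () ← ∈-setOf⁻ {L = []} (image⊆setOf {φ = φ} {W = []} (λ {i} → N⊆[] i) x∈)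
    #valid>0 {v ∷ S} unique′@(_ ∷ unique) = *-cancelˡ-< (4 * n) 0 _ (begin-strict
      4 * n * 0            ≡⟨ *-zeroʳ (4 * n) ⟩
      0                    <⟨ >-nonZero⁻¹ (3 * b * #valid S) {{m*n≢0 (3 * b) _ {{m*n≢0 3 b}} {{>-nonZero (#valid>0 unique)}}}} ⟩
      3 * b * #valid S     ≤⟨ grows (suc (length S)) S v ≤-refl unique′ ⟩
      4 * n * #valid (v ∷ S) ∎)
      where open ≤-Reasoning

    ∃-valid : ∃[ φ ] Valid (allFin m) φ
    ∃-valid = let (φ , 0<) = ∑>0⇒∃ (maps m n) (𝟙 ∘ valid? (allFin m)) (#valid>0 (Unique.allFin⁺ m)) in
      φ , 𝟙>0 (valid? (allFin m) φ) 0<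

-- From the real hypotheses to natural numbers

ι : ℕ → ℚ
ι n = ℤ.+ n ℚ./ 1

toℚᵘ-ι : ∀ n → ℚ.toℚᵘ (ι n) ℚᵘ.≃ ℚᵘ.mkℚᵘ (ℤ.+ n) 0
toℚᵘ-ι n = ℚ.toℚᵘ-fromℚᵘ (ℚᵘ.mkℚᵘ (ℤ.+ n) 0)

ι-* : ∀ m n → ι (m * n) ≡ ι m ℚ.* ι n
ι-* m n = ℚ.toℚᵘ-injective (ℚᵘ.≃-trans (toℚᵘ-ι (m * n)) (ℚᵘ.≃-sym
  (ℚᵘ.≃-trans (ℚ.toℚᵘ-homo-* (ι m) (ι n)) (ℚᵘ.≃-trans (ℚᵘ.*-cong (toℚᵘ-ι m) (toℚᵘ-ι n))
    (ℚᵘ.*≡* (cong (ℤ._* ℤ.+ 1) (sym (ℤ.pos-* m n))))))))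

ι-suc : ∀ n → ι (suc n) ≡ 1ℚ ℚ.+ ι n
ι-suc n = ℚ.toℚᵘ-injective (ℚᵘ.≃-trans (toℚᵘ-ι (suc n)) (ℚᵘ.≃-sym
  (ℚᵘ.≃-trans (ℚ.toℚᵘ-homo-+ 1ℚ (ι n)) (ℚᵘ.≃-trans (ℚᵘ.+-cong (toℚᵘ-ι 1) (toℚᵘ-ι n))
    (ℚᵘ.*≡* (cong (ℤ._* ℤ.+ 1) (cong (λ z → ℤ.+ 1 ℤ.+ z) (ℤ.*-identityʳ (ℤ.+ n)))))))))

ι-nonNeg : ∀ n → ℚ.NonNegative (ι n)
ι-nonNeg n = ℚ.normalize-nonNeg n 1

ι-cancel-< : ∀ {m n} → ι m ℚ.< ι n → m < n
ι-cancel-< {m} {n} m<n with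
  ℚᵘ.<-respʳ-≃ (toℚᵘ-ι n) (ℚᵘ.<-respˡ-≃ (toℚᵘ-ι m) (ℚ.toℚᵘ-mono-< m<n))
... | ℚᵘ.*<* m*1<n*1 = ℤ.drop‿+<+ (subst₂ ℤ._<_ (ℤ.*-identityʳ (ℤ.+ m)) (ℤ.*-identityʳ (ℤ.+ n)) m*1<n*1)

1/suc : ℕ → ℚ
1/suc n = ℤ.+ 1 ℚ./ suc n

1/suc-inverse : ∀ n → 1/suc n ℚ.* ι (suc n) ≡ 1ℚ
1/suc-inverse n = ℚ.toℚᵘ-injective (ℚᵘ.≃-trans (ℚ.toℚᵘ-homo-* (1/suc n) (ι (suc n)))
  (ℚᵘ.≃-trans (ℚᵘ.*-cong (ℚ.toℚᵘ-fromℚᵘ (ℚᵘ.mkℚᵘ (ℤ.+ 1) n)) (toℚᵘ-ι (suc n)))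
    (ℚᵘ.*≡* (cong ℤ.+_ (trans (*-identityʳ _) (trans (*-identityˡ (suc n)) (sym (trans (*-identityˡ _) (*-identityʳ (suc n))))))))))

1/suc-pos : ∀ n → ℚ.Positive (1/suc n)
1/suc-pos n = ℚ.normalize-pos 1 (suc n)

*-mono-≤ℚ : ∀ {p q r s} → 0ℚ ℚ.≤ p → 0ℚ ℚ.≤ s → p ℚ.≤ q → r ℚ.≤ s → p ℚ.* r ℚ.≤ q ℚ.* s
*-mono-≤ℚ {p} {q} {r} {s} 0≤p 0≤s p≤q r≤s = ℚ.≤-trans
  (ℚ.*-monoˡ-≤-nonNeg p {{ℚ.nonNegative 0≤p}} r≤s)
  (ℚ.*-monoʳ-≤-nonNeg s {{ℚ.nonNegative 0≤s}} p≤q)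

¾ 1/16 : ℚ
¾ = ℤ.+ 3 ℚ./ 4
1/16 = ℤ.+ 1 ℚ./ 16

-- √½ ≤ ¾ because ½ < 9/16.
√½-eventually-≤¾ : ∃[ N ] ∀ i → N ≤ i → ℚ.∣ seq √½ i ∣ ℚ.≤ ¾
√½-eventually-≤¾ = let (N , s²≤) = proj₁ √½-square 1/16 (ℚ.positive⁻¹ 1/16) in
  N , λ i N≤i → bound (seq √½ i) (s²≤ i N≤i)
  where
  bound : ∀ s → s ℚ.* s ℚ.≤ ½ ℚ.+ 1/16 → ℚ.∣ s ∣ ℚ.≤ ¾
  bound s s²≤ = ℚ.≮⇒≥ λ ¾<∣s∣ → ℚ.<-irrefl refl (begin-strict
    ½ ℚ.+ 1/16          <⟨ ℚ.*-monoʳ-<-pos ¾ ¾<∣s∣ ⟩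
    ¾ ℚ.* ℚ.∣ s ∣       ≤⟨ ℚ.*-monoʳ-≤-nonNeg ℚ.∣ s ∣ {{ℚ.∣-∣-nonNeg s}} (ℚ.<⇒≤ ¾<∣s∣) ⟩
    ℚ.∣ s ∣ ℚ.* ℚ.∣ s ∣ ≡⟨ ∣s∣²≡s² ⟩
    s ℚ.* s             ≤⟨ s²≤ ⟩
    ½ ℚ.+ 1/16          ∎)
    where
    open ℚ.≤-Reasoning
    ∣s∣²≡s² : ℚ.∣ s ∣ ℚ.* ℚ.∣ s ∣ ≡ s ℚ.* s
    ∣s∣²≡s² with ℚ.∣p∣≡p∨∣p∣≡-p s
    ... | inj₁ eq rewrite eq = refl
    ... | inj₂ eq rewrite eq = solve 1 (λ s → (:- s) :* (:- s) := s :* s) refl s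
      where open ℚ.+-*-Solver

module _ (i : ℕ) where

  ^ℝ-bound : ∀ x P Q → ℚ.∣ seq x i ∣ ℚ.* ι Q ℚ.≤ ι P →
             ∀ k → ℚ.∣ seq (x ^ℝ k) i ∣ ℚ.* ι (Q ^ k) ℚ.≤ ι (P ^ k)
  ^ℝ-bound x P Q x≤ zero = ℚ.≤-refl
  ^ℝ-bound x P Q x≤ (suc k) = begin
    ℚ.∣ s ℚ.* t ∣ ℚ.* ι (Q * Q ^ k)
      ≡⟨ cong₂ ℚ._*_ (ℚ.∣p*q∣≡∣p∣*∣q∣ s t) (ι-* Q (Q ^ k)) ⟩
    ℚ.∣ s ∣ ℚ.* ℚ.∣ t ∣ ℚ.* (ι Q ℚ.* ι (Q ^ k))
      ≡⟨ solve 4 (λ s t q r → s :* t :* (q :* r) := (s :* q) :* (t :* r)) refl ℚ.∣ s ∣ ℚ.∣ t ∣ (ι Q) (ι (Q ^ k)) ⟩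
    (ℚ.∣ s ∣ ℚ.* ι Q) ℚ.* (ℚ.∣ t ∣ ℚ.* ι (Q ^ k))
      ≤⟨ *-mono-≤ℚ (0≤∣∣* s Q) (ℚ.nonNegative⁻¹ _ {{ι-nonNeg (P ^ k)}}) x≤ (^ℝ-bound x P Q x≤ k) ⟩
    ι P ℚ.* ι (P ^ k)
      ≡⟨ ι-* P (P ^ k) ⟨
    ι (P * P ^ k) ∎
    where
    open ℚ.≤-Reasoning
    open ℚ.+-*-Solver
    s = seq x i
    t = seq (x ^ℝ k) i
    0≤∣∣* : ∀ s Q → 0ℚ ℚ.≤ ℚ.∣ s ∣ ℚ.* ι Q
    0≤∣∣* s Q = subst (ℚ._≤ ℚ.∣ s ∣ ℚ.* ι Q) (ℚ.*-zeroˡ (ι Q))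
      (ℚ.*-monoʳ-≤-nonNeg (ι Q) {{ι-nonNeg Q}} (ℚ.0≤∣p∣ s))

  √½*-bound : ℚ.∣ seq √½ i ∣ ℚ.≤ ¾ → ∀ a b .{{_ : NonZero a}} →
              ℚ.∣ seq (√½ *ℝ (fromℕ b ÷ℝ a)) i ∣ ℚ.* ι (4 * a) ℚ.≤ ι (3 * b)
  √½*-bound s≤¾ (suc a) b = begin
    ℚ.∣ seq √½ i ℚ.* (ι b ℚ.* 1/suc a) ∣ ℚ.* ι (4 * suc a)
      ≡⟨ cong₂ ℚ._*_ (trans (ℚ.∣p*q∣≡∣p∣*∣q∣ (seq √½ i) _) (cong (ℚ.∣ seq √½ i ∣ ℚ.*_)
           (trans (ℚ.∣p*q∣≡∣p∣*∣q∣ (ι b) (1/suc a)) (cong₂ ℚ._*_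
             (ℚ.0≤p⇒∣p∣≡p (ℚ.nonNegative⁻¹ (ι b) {{ι-nonNeg b}}))
             (ℚ.0≤p⇒∣p∣≡p (ℚ.<⇒≤ (ℚ.positive⁻¹ (1/suc a) {{1/suc-pos a}})))))))
           (ι-* 4 (suc a)) ⟩
    ℚ.∣ seq √½ i ∣ ℚ.* (ι b ℚ.* 1/suc a) ℚ.* (ι 4 ℚ.* ι (suc a))
      ≡⟨ solve 5 (λ s b r f a → s :* (b :* r) :* (f :* a) := s :* f :* b :* (r :* a)) refl
           ℚ.∣ seq √½ i ∣ (ι b) (1/suc a) (ι 4) (ι (suc a)) ⟩
    ℚ.∣ seq √½ i ∣ ℚ.* ι 4 ℚ.* ι b ℚ.* (1/suc a ℚ.* ι (suc a))
      ≡⟨ trans (cong (ℚ.∣ seq √½ i ∣ ℚ.* ι 4 ℚ.* ι b ℚ.*_) (1/suc-inverse a)) (ℚ.*-identityʳ _) ⟩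
    ℚ.∣ seq √½ i ∣ ℚ.* ι 4 ℚ.* ι b
      ≤⟨ ℚ.*-monoʳ-≤-nonNeg (ι b) {{ι-nonNeg b}} (ℚ.*-monoʳ-≤-nonNeg (ι 4) s≤¾) ⟩
    ι 3 ℚ.* ι b
      ≡⟨ ι-* 3 b ⟨
    ι (3 * b) ∎
    where
    open ℚ.≤-Reasoning
    open ℚ.+-*-Solver

  ÷ℝ-bound : ∀ x P Q K → ℚ.∣ seq x i ∣ ℚ.* ι Q ℚ.≤ ι P →
             seq (x ÷ℝ suc K) i ℚ.* ι (suc K * Q) ℚ.≤ ι P
  ÷ℝ-bound x P Q K x≤ = begin
    s ℚ.* 1/suc K ℚ.* ι (suc K * Q)
      ≡⟨ cong (s ℚ.* 1/suc K ℚ.*_) (ι-* (suc K) Q) ⟩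
    s ℚ.* 1/suc K ℚ.* (ι (suc K) ℚ.* ι Q)
      ≡⟨ solve 4 (λ s r k q → s :* r :* (k :* q) := s :* q :* (r :* k)) refl s (1/suc K) (ι (suc K)) (ι Q) ⟩
    s ℚ.* ι Q ℚ.* (1/suc K ℚ.* ι (suc K))
      ≡⟨ trans (cong (s ℚ.* ι Q ℚ.*_) (1/suc-inverse K)) (ℚ.*-identityʳ _) ⟩
    s ℚ.* ι Q
      ≤⟨ ℚ.*-monoʳ-≤-nonNeg (ι Q) {{ι-nonNeg Q}} (p≤∣p∣ s) ⟩
    ℚ.∣ s ∣ ℚ.* ι Q
      ≤⟨ x≤ ⟩
    ι P ∎
    where
    open ℚ.≤-Reasoning
    open ℚ.+-*-Solver
    s = seq x i
    p≤∣p∣ : ∀ p → p ℚ.≤ ℚ.∣ p ∣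
    p≤∣p∣ p with ℚ.≤-total 0ℚ p
    ... | inj₁ 0≤p = ℚ.≤-reflexive (sym (ℚ.0≤p⇒∣p∣≡p 0≤p))
    ... | inj₂ p≤0 = ℚ.≤-trans p≤0 (ℚ.0≤∣p∣ p)

clear-denominators : ∀ {δ y ε L : ℚ} {X C P : ℕ} → ℚ.NonNegative L →
  ι X ℚ.≤ δ ℚ.* ι C ℚ.+ ε → δ ℚ.≤ y ℚ.+ ε → y ℚ.* L ℚ.≤ ι P →
  ι X ℚ.* L ℚ.≤ ι P ℚ.* ι C ℚ.+ ε ℚ.* ((1ℚ ℚ.+ ι C) ℚ.* L)
clear-denominators {δ = δ} {y} {ε} {L} {X = X} {C} {P} L≥0 X≤ δ≤ y≤ = begin
  ι X ℚ.* L
    ≤⟨ ℚ.*-monoʳ-≤-nonNeg L {{L≥0}} X≤ ⟩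
  (δ ℚ.* ι C ℚ.+ ε) ℚ.* L
    ≤⟨ ℚ.*-monoʳ-≤-nonNeg L {{L≥0}} (ℚ.+-monoˡ-≤ ε (ℚ.*-monoʳ-≤-nonNeg (ι C) {{ι-nonNeg C}} δ≤)) ⟩
  ((y ℚ.+ ε) ℚ.* ι C ℚ.+ ε) ℚ.* L
    ≡⟨ solve 4 (λ y e c l → ((y :+ e) :* c :+ e) :* l := y :* l :* c :+ e :* ((con 1ℚ :+ c) :* l)) refl y ε (ι C) L ⟩
  y ℚ.* L ℚ.* ι C ℚ.+ ε ℚ.* ((1ℚ ℚ.+ ι C) ℚ.* L)
    ≤⟨ ℚ.+-monoˡ-≤ _ (ℚ.*-monoʳ-≤-nonNeg (ι C) {{ι-nonNeg C}} y≤) ⟩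
  ι P ℚ.* ι C ℚ.+ ε ℚ.* ((1ℚ ℚ.+ ι C) ℚ.* L) ∎
  where
  open ℚ.≤-Reasoning
  open ℚ.+-*-Solver

exceptional-≤ : ∀ (X C a b K Δ : ℕ) .{{_ : NonZero a}} (δ : ℝ) →
  δ ≤ℝ (√½ *ℝ (fromℕ b ÷ℝ a)) ^ℝ Δ ÷ℝ K → fromℕ X ≤ℝ δ *ℝ fromℕ C →
  X * (K * (4 * a) ^ Δ) ≤ (3 * b) ^ Δ * C
exceptional-≤ X C a b zero    Δ δ δ≤ X≤ = ≤-trans (≤-reflexive (*-zeroʳ X)) z≤n
exceptional-≤ X C a b (suc K) Δ δ δ≤ X≤ =
  let
    (N₁ , ≤¾) = √½-eventually-≤¾
    (N₂ , δ≤′) = δ≤ ε 0<ε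
    (N₃ , X≤′) = X≤ ε 0<ε
    i = N₁ ⊔ (N₂ ⊔ N₃)
    N₁≤i = m≤m⊔n N₁ (N₂ ⊔ N₃)
    N₂≤i = ≤-trans (m≤m⊔n N₂ N₃) (m≤n⊔m N₁ (N₂ ⊔ N₃))
    N₃≤i = ≤-trans (m≤n⊔m N₂ N₃) (m≤n⊔m N₁ (N₂ ⊔ N₃))
    x = √½ *ℝ (fromℕ b ÷ℝ a)
    y≤ = ÷ℝ-bound i (x ^ℝ Δ) num den K
      (^ℝ-bound i x (3 * b) (4 * a) (√½*-bound i (≤¾ i N₁≤i) a b) Δ)
  in finish (seq δ i) (seq (x ^ℝ Δ ÷ℝ suc K) i) (X≤′ i N₃≤i) (δ≤′ i N₂≤i) y≤
  where
  num = (3 * b) ^ Δ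
  den = (4 * a) ^ Δ
  L = suc K * den
  ε = 1/suc (suc C * L)
  0<ε : 0ℚ ℚ.< ε
  0<ε = ℚ.positive⁻¹ ε {{1/suc-pos (suc C * L)}}
  finish : ∀ δ y → ι X ℚ.≤ δ ℚ.* ι C ℚ.+ ε → δ ℚ.≤ y ℚ.+ ε → y ℚ.* ι L ℚ.≤ ι num →
           X * L ≤ num * C
  finish δ y X≤ δ≤ y≤ = s≤s⁻¹ (ι-cancel-< (begin-strict
    ι (X * L)                                    ≡⟨ ι-* X L ⟩
    ι X ℚ.* ι L                                    ≤⟨ clear-denominators {δ} {y} {ε} {ι L} {X} {C} {num} (ι-nonNeg L) X≤ δ≤ y≤ ⟩
    ι num ℚ.* ι C ℚ.+ ε ℚ.* ((1ℚ ℚ.+ ι C) ℚ.* ι L)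
      ≡⟨ cong₂ (λ p q → p ℚ.+ ε ℚ.* q) (sym (ι-* num C)) (trans (cong (ℚ._* ι L) (sym (ι-suc C))) (sym (ι-* (suc C) L))) ⟩
    ι (num * C) ℚ.+ ε ℚ.* ι (suc C * L)
      <⟨ ℚ.+-monoʳ-< (ι (num * C)) εM<1 ⟩
    ι (num * C) ℚ.+ 1ℚ
      ≡⟨ trans (ℚ.+-comm (ι (num * C)) 1ℚ) (sym (ι-suc (num * C))) ⟩
    ι (suc (num * C)) ∎))
    where
    open ℚ.≤-Reasoning
    M = suc C * L
    εM<1 : ε ℚ.* ι M ℚ.< 1ℚ
    εM<1 = begin-strict
      ε ℚ.* ι M             ≡⟨ ℚ.+-identityˡ (ε ℚ.* ι M) ⟨
      0ℚ ℚ.+ ε ℚ.* ι M      <⟨ ℚ.+-monoˡ-< (ε ℚ.* ι M) 0<ε ⟩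
      ε ℚ.+ ε ℚ.* ι M       ≡⟨ solve 2 (λ e m → e :+ e :* m := e :* (con 1ℚ :+ m)) refl ε (ι M) ⟩
      ε ℚ.* (1ℚ ℚ.+ ι M)    ≡⟨ cong (ε ℚ.*_) (ι-suc M) ⟨
      ε ℚ.* ι (suc M)       ≡⟨ 1/suc-inverse M ⟩
      1ℚ                    ∎
      where open ℚ.+-*-Solver

-- Degrees and common out-neighbourhoods

module _ (T : Tournament n) where
  open Tournament T

  commonOutNbrs-anti : ∀ {R S} → R ⊆ S → commonOutNbrs T S ⊆ commonOutNbrs T R
  commonOutNbrs-anti {R} {S} R⊆S w∈ =
    ∈-comprehension⁺ (λ w → all? (λ v → (v ∈? R) →-dec (v ⟶? w)))
      λ v v∈R → ∈-comprehension⁻ (λ w → all? (λ v → (v ∈? S) →-dec (v ⟶? w))) w∈ v (R⊆S v∈R)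

  ∣commonOutNbrs∩∣-anti : ∀ B {R S} → R ⊆ S → ∣ commonOutNbrs T S ∩ B ∣ ≤ ∣ commonOutNbrs T R ∩ B ∣
  ∣commonOutNbrs∩∣-anti B {R} {S} R⊆S = p⊆q⇒∣p∣≤∣q∣ λ w∈ →
    let (w∈S⁺ , w∈B) = x∈p∩q⁻ (commonOutNbrs T S) B w∈ in
    x∈p∩q⁺ (commonOutNbrs-anti R⊆S w∈S⁺ , w∈B)

module _ (D : BipartiteDigraph m k) where
  open BipartiteDigraph D

  ∣inNbrs∣≤Δ⁻ : ∀ u → ∣ inNbrs D u ∣ ≤ Δ⁻ D
  ∣inNbrs∣≤Δ⁻ u = All.lookup (All.map⁻ (xs≤max 0 (map (λ u → ∣ inNbrs D u ∣) (allFin k)))) (∈-allFin u)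

  ∣outNbrs∣≤Δ⁺ : ∀ v → ∣ outNbrs D v ∣ ≤ Δ⁺ D
  ∣outNbrs∣≤Δ⁺ v = All.lookup (All.map⁻ (xs≤max 0 (map (λ v → ∣ outNbrs D v ∣) (allFin m)))) (∈-allFin v)

  ∑-inNbrs≡∣outNbrs∣ : ∀ v → ∑ (allFin k) (λ u → 𝟙 (v ∈? inNbrs D u)) ≡ ∣ outNbrs D v ∣
  ∑-inNbrs≡∣outNbrs∣ v = trans
    (∑-cong (allFin k) λ u → 𝟙-cong (v ∈? inNbrs D u) (u ∈? outNbrs D v)
      (∈-comprehension⁺ (v ⟶?_) ∘ ∈-comprehension⁻ (_⟶? u))
      (∈-comprehension⁺ (_⟶? u) ∘ ∈-comprehension⁻ (v ⟶?_)))
    (∑-𝟙-∈ (outNbrs D v))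

  Δ⁻-attained : 1 ≤ Δ⁻ D → ∃[ u ] Δ⁻ D ≡ ∣ inNbrs D u ∣
  Δ⁻-attained 1≤Δ⁻ with argmax-sel id 0 (map (λ u → ∣ inNbrs D u ∣) (allFin k))
  ... | inj₁ Δ⁻≡0 = contradiction Δ⁻≡0 (m<n⇒n≢0 1≤Δ⁻)
  ... | inj₂ Δ⁻∈  = let (u , _ , Δ⁻≡) = ∈-map⁻ (λ u → ∣ inNbrs D u ∣) Δ⁻∈ in u , Δ⁻≡

  ∃-edge : 1 ≤ Δ⁻ D → ∃[ u ] ∃[ v ] v ∈ inNbrs D u
  ∃-edge 1≤Δ⁻ =
    let (u , Δ⁻≡) = Δ⁻-attained 1≤Δ⁻
        (v , 0<)  = ∑>0⇒∃ (allFin m) (λ v → 𝟙 (v ∈? inNbrs D u))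
                      (subst (0 <_) (trans Δ⁻≡ (sym (∑-𝟙-∈ (inNbrs D u)))) 1≤Δ⁻)
    in u , v , 𝟙>0 (v ∈? inNbrs D u) 0<

  Δ⁻≤m : 1 ≤ Δ⁻ D → Δ⁻ D ≤ m
  Δ⁻≤m 1≤Δ⁻ = let (u , Δ⁻≡) = Δ⁻-attained 1≤Δ⁻ in ≤-trans (≤-reflexive Δ⁻≡) (∣p∣≤n (inNbrs D u))

  Δ⁺>0 : 1 ≤ Δ⁻ D → 0 < Δ⁺ D
  Δ⁺>0 1≤Δ⁻ = let (u , v , v∈) = ∃-edge 1≤Δ⁻ in begin
    1                                               ≡⟨ 𝟙-yes (v ∈? inNbrs D u) v∈ ⟨
    𝟙 (v ∈? inNbrs D u)                             ≤⟨ ≤∑ (λ u → 𝟙 (v ∈? inNbrs D u)) (∈-allFin u) ⟩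
    ∑ (allFin k) (λ u → 𝟙 (v ∈? inNbrs D u))        ≡⟨ ∑-inNbrs≡∣outNbrs∣ v ⟩
    ∣ outNbrs D v ∣                                 ≤⟨ ∣outNbrs∣≤Δ⁺ v ⟩
    Δ⁺ D                                            ∎
    where open ≤-Reasoning

unique-map⇒injective : ∀ {A B : Set} {f : A → B} {xs} → Unique (map f xs) →
                       ∀ {x y} → x ∈ˡ xs → y ∈ˡ xs → f x ≡ f y → x ≡ y
unique-map⇒injective _ (here refl) (here refl) _ = refl
unique-map⇒injective {f = f} (fx∉ ∷ _) (here refl) (there y∈) fx≡fy =
  contradiction fx≡fy (All.lookup fx∉ (∈-map⁺ f y∈))
unique-map⇒injective {f = f} (fy∉ ∷ _) (there x∈) (here refl) fx≡fy =
  contradiction (sym fx≡fy) (All.lookup fy∉ (∈-map⁺ f x∈))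
unique-map⇒injective (_ ∷ unique) (there x∈) (there y∈) = unique-map⇒injective unique x∈ y∈

lemma2p4 : ∀ {m k n} (D : BipartiteDigraph m k) → 1 ≤ Δ⁻ D →
    (a b c : ℕ) (δ : ℝ) → 0ℝ <ℝ δ → b ≤ a → 32 * m ≤ b →
    δ ≤ℝ (√½ *ℝ (fromℕ b ÷ℝ a)) ^ℝ Δ⁻ D ÷ℝ (4 * Δ⁺ D * Δ⁻ D) →
    (T : Tournament n) (A B : Subset n) → ∣ A ∣ ≡ a →
    fromℕ (length (exceptional T A B (Δ⁻ D) c)) ≤ℝ δ *ℝ fromℕ (length (choose A (Δ⁻ D))) →
    (f : Fin m → Subset n) → (∀ v → f v ⊆ A) → (∀ v → b ≤ ∣ f v ∣) →
    ∃[ φ ] Injective _≡_ _≡_ φ × (∀ v → φ v ∈ A) × (∀ v → φ v ∈ f v) ×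
    (∀ u → c ≤ ∣ commonOutNbrs T (image φ (inNbrs D u)) ∩ B ∣)
lemma2p4 {m} {k} {n} D 1≤Δ⁻ _ b c δ _ b≤a 32m≤b δ≤ T A B refl few f f⊆A b≤ =
  let (φ , ∈f , unique , good) = ∃-valid b (Δ⁺ D) (4 * Δ⁺ D * Δ⁻ D) (Δ⁻ D) b≤ b≤a 32m≤b
        (m≤m*n (4 * Δ⁺ D) (Δ⁻ D)) (Δ⁻≤m D 1≤Δ⁻) (∣inNbrs∣≤Δ⁻ D)
        (λ v → ≤-trans (≤-reflexive (∑-inNbrs≡∣outNbrs∣ D v)) (∣outNbrs∣≤Δ⁺ D v))
        (exceptional-≤ (length (exceptional T A B (Δ⁻ D) c)) (length (choose A (Δ⁻ D))) ∣ A ∣ b (4 * Δ⁺ D * Δ⁻ D) (Δ⁻ D) δ δ≤ few)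
      φv∈fv v = All.lookup ∈f (∈-allFin v)
  in lookup φ , unique-map⇒injective unique (∈-allFin _) (∈-allFin _) ,
     (λ v → f⊆A v (φv∈fv v)) , φv∈fv ,
     λ u → decidable-stable (c ≤? _) (good u λ i _ → ∈-allFin i)
  where
  m>0 : 0 < m
  m>0 = ≤-trans 1≤Δ⁻ (Δ⁻≤m D 1≤Δ⁻)
  b>0 : 0 < b
  b>0 = ≤-trans m>0 (≤-trans (m≤n*m m 32) 32m≤b)
  instance
    Δ⁻≢0 : NonZero (Δ⁻ D)
    Δ⁻≢0 = >-nonZero 1≤Δ⁻
    Δ⁺≢0 : NonZero (Δ⁺ D)
    Δ⁺≢0 = >-nonZero (Δ⁺>0 D 1≤Δ⁻)
    b≢0 : NonZero b
    b≢0 = >-nonZero b>0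
    a≢0 : NonZero ∣ A ∣
    a≢0 = >-nonZero (≤-trans b>0 b≤a)
    n≢0 : NonZero n
    n≢0 = >-nonZero (≤-trans b>0 (≤-trans b≤a (∣p∣≤n A)))
  exceptional? : U.Decidable (λ S → ¬ c ≤ ∣ commonOutNbrs T S ∩ B ∣)
  exceptional? S = ¬? (c ≤? ∣ commonOutNbrs T S ∩ B ∣)
  exceptional-mono : ∀ {R S} → R ⊆ S → ¬ c ≤ ∣ commonOutNbrs T R ∩ B ∣ → ¬ c ≤ ∣ commonOutNbrs T S ∩ B ∣
  exceptional-mono R⊆S c≰ c≤ = c≰ (≤-trans c≤ (∣commonOutNbrs∩∣-anti T B R⊆S))
  open Embedding A exceptional? exceptional-mono f f⊆A (inNbrs D)
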